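{- Fix a configuration of four pairwise intersecting line segments in $\mathbb{R}^2$ in which no three intersect at the same point. Such segments necessarily bound a quadrilateral $Q$ and two triangles $T_1$ and $T_2$. Label the sides of $Q$ as $A_1,A_2,A_3,A_4$ and the remaining sides of the two triangles as $B_1,B_2,B_3,B_4$ following the labeling convention given in the context, let $a_i>0$ be the length of $A_i$, and write the length of $B_i$ as $b_i a_i$ with $b_i>0$, for $i=1,\dots,4$. Then the ratios $b_1,\ldots,b_4$ satisfy $$b_2 b_3 = b_1(b_2+1) \qquad\text{and}\qquad b_1 b_4 = (b_1+1) b_2.$$ In particular, specifying rational values for any two of the $b_i$'s uniquely determines rational values for the other two.
   Context: Labeling convention. The four segments lie on four lines $\ell_1,\ell_2,\ell_3,\ell_4$, and have six pairwise intersection points. The lines are labeled so that the bounded quadrilateral $Q$ has sides $A_1,A_2,A_3,A_4$ in cyclic order with $A_i \subset \ell_i$; write $P_{12}=A_1\cap A_2$, $P_{23}=A_2\cap A_3$, $P_{34}=A_3\cap A_4$, $P_{41}=A_4\cap A_1$ for its vertices. The remaining two intersection points are $X=\ell_1\cap\ell_3$ and $Y=\ell_2\cap\ell_4$. The labels are chosen so that $X$ lies on $\ell_1$ beyond $P_{41}$ (i.e. $P_{41}$ lies strictly between $P_{12}$ and $X$) and on $\ell_3$ beyond $P_{34}$ (i.e. $P_{34}$ lies strictly between $P_{23}$ and $X$), while $Y$ lies on $\ell_2$ beyond $P_{23}$ (i.e. $P_{23}$ lies strictly between $P_{12}$ and $Y$) and on $\ell_4$ beyond $P_{34}$ (i.e.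 $P_{34}$ lies strictly between $P_{41}$ and $Y$). The two bounded triangles are the triangle with vertices $P_{41},P_{34},X$, whose sides are $A_4$, $B_1=P_{41}X$ and $B_3=P_{34}X$, and the triangle with vertices $P_{34},P_{23},Y$, whose sides are $A_3$, $B_2=P_{23}Y$ and $B_4=P_{34}Y$. Thus each $B_i$ lies on the same line $\ell_i$ as $A_i$ and extends it. -}

module Defs where

open import Data.Fin.Base using (Fin)
open import Data.Fin.Patterns using (0F; 1F; 2F; 3F)
open import Data.Fin.Permutation using (Permutation′; _⟨$⟩ʳ_)
open import Data.Nat.Base as ℕ using (ℕ)
import Data.Nat.Properties as ℕ
open import Data.Product.Base using (_×_; _,_; ∃-syntax)
open import Data.Rational.Base as ℚ using (ℚ; 0ℚ; 1ℚ; ½; ∣_∣; positive)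
import Data.Rational.Properties as ℚ
open import Data.Rational.Solver using (module +-*-Solver)
open import Relation.Binary.PropositionalEquality
  using (_≡_; _≢_; refl; sym; trans; cong; subst)
open import Relation.Nullary.Negation using (¬_)

-- ℝ is the setoid of Cauchy sequences of rationals, compared by the setoid
-- equality _≈_ (the difference tends to 0).

IsCauchy : (ℕ → ℚ) → Set
IsCauchy x = ∀ ε → 0ℚ ℚ.< ε →
  ∃[ N ] ∀ m n → N ℕ.≤ m → N ℕ.≤ n → ∣ x m ℚ.- x n ∣ ℚ.< ε

record ℝ : Set where
  constructor mkℝ
  field
    seq    : ℕ → ℚ
    cauchy : IsCauchy seq

open ℝ public

infix 4 _≈_ _<_ _≤_

_≈_ : ℝ → ℝ → Set
x ≈ y = ∀ ε → 0ℚ ℚ.< ε →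
  ∃[ N ] ∀ n → N ℕ.≤ n → ∣ seq x n ℚ.- seq y n ∣ ℚ.< ε

-- The gap ε does not depend on n: pointwise strict inequality of the
-- sequences would not be invariant under _≈_.
_<_ : ℝ → ℝ → Set
x < y = ∃[ ε ] (0ℚ ℚ.< ε) × (∃[ N ] ∀ n → N ℕ.≤ n → seq x n ℚ.+ ε ℚ.≤ seq y n)

_≤_ : ℝ → ℝ → Set
x ≤ y = ¬ (y < x)

private
  half-pos : ∀ {ε} → 0ℚ ℚ.< ε → 0ℚ ℚ.< ½ ℚ.* ε
  half-pos {ε} ε>0 = subst (ℚ._< ½ ℚ.* ε) (ℚ.*-zeroʳ ½) (ℚ.*-monoʳ-<-pos ½ ε>0)

  halves : ∀ ε → ½ ℚ.* ε ℚ.+ ½ ℚ.* ε ≡ ε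
  halves ε = trans (sym (ℚ.*-distribʳ-+ ε ½ ½)) (ℚ.*-identityˡ ε)

  +-split : ∀ a b c d → (a ℚ.+ b) ℚ.- (c ℚ.+ d) ≡ (a ℚ.- c) ℚ.+ (b ℚ.- d)
  +-split = solve 4 (λ a b c d → (a :+ b) :- (c :+ d) := (a :- c) :+ (b :- d)) refl
    where open +-*-Solver

  *-split : ∀ a b c d →
    a ℚ.* b ℚ.- c ℚ.* d ≡ a ℚ.* (b ℚ.- d) ℚ.+ d ℚ.* (a ℚ.- c)
  *-split = solve 4 (λ a b c d →
      a :* b :- c :* d := a :* (b :- d) :+ d :* (a :- c)) refl
    where open +-*-Solver

  neg-split : ∀ a b → (ℚ.- a) ℚ.- (ℚ.- b) ≡ ℚ.- (a ℚ.- b)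
  neg-split = solve 2 (λ a b → (:- a) :- (:- b) := :- (a :- b)) refl
    where open +-*-Solver

  reinsert : ∀ a b → (a ℚ.- b) ℚ.+ b ≡ a
  reinsert = solve 2 (λ a b → (a :- b) :+ b := a) refl
    where open +-*-Solver

  bounded : ∀ x → IsCauchy x →
    ∃[ B ] (0ℚ ℚ.< B) × (∃[ N ] ∀ n → N ℕ.≤ n → ∣ x n ∣ ℚ.≤ B)
  bounded x c =
    let N , h = c 1ℚ (ℚ.positive⁻¹ 1ℚ) in
    1ℚ ℚ.+ ∣ x N ∣ , ℚ.+-mono-<-≤ (ℚ.positive⁻¹ 1ℚ) (ℚ.0≤∣p∣ (x N)) , N , λ n N≤n → begin
    ∣ x n ∣                        ≡⟨ cong ∣_∣ (sym (reinsert (x n) (x N))) ⟩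
    ∣ (x n ℚ.- x N) ℚ.+ x N ∣      ≤⟨ ℚ.∣p+q∣≤∣p∣+∣q∣ (x n ℚ.- x N) (x N) ⟩
    ∣ x n ℚ.- x N ∣ ℚ.+ ∣ x N ∣    ≤⟨ ℚ.+-monoˡ-≤ ∣ x N ∣ (ℚ.<⇒≤ (h n N N≤n ℕ.≤-refl)) ⟩
    1ℚ ℚ.+ ∣ x N ∣                 ∎
    where open ℚ.≤-Reasoning

  mul-< : ∀ {B δ} p q → 0ℚ ℚ.< B → ∣ p ∣ ℚ.≤ B → ∣ q ∣ ℚ.< δ →
    ∣ p ℚ.* q ∣ ℚ.< B ℚ.* δ
  mul-< {B} {δ} p q B>0 p≤B q<δ = begin-strict
    ∣ p ℚ.* q ∣      ≡⟨ ℚ.∣p*q∣≡∣p∣*∣q∣ p q ⟩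
    ∣ p ∣ ℚ.* ∣ q ∣  ≤⟨ ℚ.*-monoʳ-≤-nonNeg ∣ q ∣ {{ℚ.∣-∣-nonNeg q}} p≤B ⟩
    B ℚ.* ∣ q ∣      <⟨ ℚ.*-monoʳ-<-pos B {{positive B>0}} q<δ ⟩
    B ℚ.* δ          ∎
    where open ℚ.≤-Reasoning

  divide : ∀ {B ε} → 0ℚ ℚ.< B → 0ℚ ℚ.< ε → ∃[ δ ] (0ℚ ℚ.< δ) × (B ℚ.* δ ≡ ε)
  divide {B} {ε} B>0 ε>0 =
    1/B ℚ.* ε
    , subst (ℚ._< 1/B ℚ.* ε) (ℚ.*-zeroʳ 1/B)
        (ℚ.*-monoʳ-<-pos 1/B {{ℚ.1/pos⇒pos B {{B⁺}}}} ε>0)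
    , trans (sym (ℚ.*-assoc B 1/B ε))
        (trans (cong (ℚ._* ε) (ℚ.*-inverseʳ B {{B≠0}})) (ℚ.*-identityˡ ε))
    where
    B⁺  = positive B>0
    B≠0 = ℚ.pos⇒nonZero B {{B⁺}}
    1/B = (ℚ.1/ B) {{B≠0}}

  const-cauchy : ∀ q → IsCauchy (λ _ → q)
  const-cauchy q ε ε>0 =
    0 , λ _ _ _ _ → subst (ℚ._< ε) (sym (cong ∣_∣ (ℚ.+-inverseʳ q))) ε>0

  +-cauchy : ∀ x y → IsCauchy x → IsCauchy y → IsCauchy (λ n → x n ℚ.+ y n)
  +-cauchy x y cx cy ε ε>0 =
    let M , f = cx (½ ℚ.* ε) (half-pos ε>0)
        N , g = cy (½ ℚ.* ε) (half-pos ε>0)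
    in M ℕ.⊔ N , λ m n K≤m K≤n → begin-strict
    ∣ (x m ℚ.+ y m) ℚ.- (x n ℚ.+ y n) ∣
      ≡⟨ cong ∣_∣ (+-split (x m) (y m) (x n) (y n)) ⟩
    ∣ (x m ℚ.- x n) ℚ.+ (y m ℚ.- y n) ∣
      ≤⟨ ℚ.∣p+q∣≤∣p∣+∣q∣ (x m ℚ.- x n) (y m ℚ.- y n) ⟩
    ∣ x m ℚ.- x n ∣ ℚ.+ ∣ y m ℚ.- y n ∣
      <⟨ ℚ.+-mono-< (f m n (ℕ.m⊔n≤o⇒m≤o M N K≤m) (ℕ.m⊔n≤o⇒m≤o M N K≤n))
                    (g m n (ℕ.m⊔n≤o⇒n≤o M N K≤m) (ℕ.m⊔n≤o⇒n≤o M N K≤n)) ⟩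
    ½ ℚ.* ε ℚ.+ ½ ℚ.* ε
      ≡⟨ halves ε ⟩
    ε ∎
    where open ℚ.≤-Reasoning

  neg-cauchy : ∀ x → IsCauchy x → IsCauchy (λ n → ℚ.- x n)
  neg-cauchy x cx ε ε>0 = let N , f = cx ε ε>0 in N , λ m n N≤m N≤n → subst (ℚ._< ε)
    (sym (trans (cong ∣_∣ (neg-split (x m) (x n))) (ℚ.∣-p∣≡∣p∣ (x m ℚ.- x n))))
    (f m n N≤m N≤n)

  *-cauchy : ∀ x y → IsCauchy x → IsCauchy y → IsCauchy (λ n → x n ℚ.* y n)
  *-cauchy x y cx cy ε ε>0 =
    let B , B>0 , K , f = bounded x cx
        C , C>0 , L , g = bounded y cy
        δ , δ>0 , eq    = divide (ℚ.+-mono-< B>0 C>0) ε>0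
        M , h           = cx δ δ>0
        N , k           = cy δ δ>0
    in (K ℕ.⊔ L) ℕ.⊔ (M ℕ.⊔ N) , λ m n ≤m ≤n →
    let KL≤m = ℕ.m⊔n≤o⇒m≤o (K ℕ.⊔ L) (M ℕ.⊔ N) ≤m
        KL≤n = ℕ.m⊔n≤o⇒m≤o (K ℕ.⊔ L) (M ℕ.⊔ N) ≤n
        MN≤m = ℕ.m⊔n≤o⇒n≤o (K ℕ.⊔ L) (M ℕ.⊔ N) ≤m
        MN≤n = ℕ.m⊔n≤o⇒n≤o (K ℕ.⊔ L) (M ℕ.⊔ N) ≤n
    in begin-strict
    ∣ x m ℚ.* y m ℚ.- x n ℚ.* y n ∣
      ≡⟨ cong ∣_∣ (*-split (x m) (y m) (x n) (y n)) ⟩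
    ∣ x m ℚ.* (y m ℚ.- y n) ℚ.+ y n ℚ.* (x m ℚ.- x n) ∣
      ≤⟨ ℚ.∣p+q∣≤∣p∣+∣q∣ (x m ℚ.* (y m ℚ.- y n)) (y n ℚ.* (x m ℚ.- x n)) ⟩
    ∣ x m ℚ.* (y m ℚ.- y n) ∣ ℚ.+ ∣ y n ℚ.* (x m ℚ.- x n) ∣
      <⟨ ℚ.+-mono-<
           (mul-< (x m) (y m ℚ.- y n) B>0 (f m (ℕ.m⊔n≤o⇒m≤o K L KL≤m))
             (k m n (ℕ.m⊔n≤o⇒n≤o M N MN≤m) (ℕ.m⊔n≤o⇒n≤o M N MN≤n)))
           (mul-< (y n) (x m ℚ.- x n) C>0 (g n (ℕ.m⊔n≤o⇒n≤o K L KL≤n))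
             (h m n (ℕ.m⊔n≤o⇒m≤o M N MN≤m) (ℕ.m⊔n≤o⇒m≤o M N MN≤n))) ⟩
    B ℚ.* δ ℚ.+ C ℚ.* δ
      ≡⟨ sym (ℚ.*-distribʳ-+ δ B C) ⟩
    (B ℚ.+ C) ℚ.* δ
      ≡⟨ eq ⟩
    ε ∎
    where open ℚ.≤-Reasoning

infixl 6 _+_ _-_
infixl 7 _*_
infix  8 -_

fromℚ : ℚ → ℝ
fromℚ q = mkℝ (λ _ → q) (const-cauchy q)

0ℝ 1ℝ : ℝ
0ℝ = fromℚ 0ℚ
1ℝ = fromℚ 1ℚ

_+_ : ℝ → ℝ → ℝ
x + y = mkℝ (λ n → seq x n ℚ.+ seq y n) (+-cauchy (seq x) (seq y) (cauchy x) (cauchy y))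

-_ : ℝ → ℝ
- x = mkℝ (λ n → ℚ.- seq x n) (neg-cauchy (seq x) (cauchy x))

_-_ : ℝ → ℝ → ℝ
x - y = x + (- y)

_*_ : ℝ → ℝ → ℝ
x * y = mkℝ (λ n → seq x n ℚ.* seq y n) (*-cauchy (seq x) (seq y) (cauchy x) (cauchy y))

record Point : Set where
  constructor pt
  field
    xc yc : ℝ

open Point public

infix 4 _≈ₚ_ _∈_

_≈ₚ_ : Point → Point → Set
P ≈ₚ R = (xc P ≈ xc R) × (yc P ≈ yc R)

-- (1 - t) P + t R
along : Point → Point → ℝ → Point
along P R t = pt (xc P + t * (xc R - xc P)) (yc P + t * (yc R - yc P))

record Segment : Set where
  field
    start end : Point
    distinct  : ¬ (start ≈ₚ end)

open Segment public

_∈_ : Point → Segment → Set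
P ∈ s = ∃[ t ] (0ℝ ≤ t) × (t ≤ 1ℝ) × (P ≈ₚ along (start s) (end s) t)

-- StrictlyBetween P R T : the point R lies in the open segment from P to T.
StrictlyBetween : Point → Point → Point → Set
StrictlyBetween P R T =
  ¬ (P ≈ₚ T) × (∃[ t ] (0ℝ < t) × (t < 1ℝ) × (R ≈ₚ along P T t))

distance² : Point → Point → ℝ
distance² P R = (xc R - xc P) * (xc R - xc P) + (yc R - yc P) * (yc R - yc P)

-- √ is not defined on ℝ here: the length of PR is the nonnegative real
-- whose square is distance² P R, which determines it up to _≈_.
IsLength : ℝ → Point × Point → Set
IsLength ℓ (P , R) = (0ℝ ≤ ℓ) × (ℓ * ℓ ≈ distance² P R)

record IsConfiguration (S : Fin 4 → Segment) : Set where
  field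
    pairwise-meet : ∀ i j → i ≢ j → ∃[ P ] (P ∈ S i) × (P ∈ S j)
    no-three-meet : ∀ i j k → i ≢ j → j ≢ k → i ≢ k →
                    ∀ P → ¬ ((P ∈ S i) × (P ∈ S j) × (P ∈ S k))

-- Indices 1, 2, 3, 4 are represented by 0F, 1F, 2F, 3F.  The given
-- segments come in arbitrary order; `order` says which of them is to
-- play the role of the i-th one.
record Labelling (S : Fin 4 → Segment) : Set where
  field
    order : Permutation′ 4

  s : Fin 4 → Segment
  s i = S (order ⟨$⟩ʳ i)

  field
    P₁₂ P₂₃ P₃₄ P₄₁ X Y : Point

    P₁₂∈ : (P₁₂ ∈ s 0F) × (P₁₂ ∈ s 1F)
    P₂₃∈ : (P₂₃ ∈ s 1F) × (P₂₃ ∈ s 2F)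
    P₃₄∈ : (P₃₄ ∈ s 2F) × (P₃₄ ∈ s 3F)
    P₄₁∈ : (P₄₁ ∈ s 3F) × (P₄₁ ∈ s 0F)
    X∈   : (X ∈ s 0F) × (X ∈ s 2F)
    Y∈   : (Y ∈ s 1F) × (Y ∈ s 3F)

    on-ℓ₁ : StrictlyBetween P₁₂ P₄₁ X
    on-ℓ₂ : StrictlyBetween P₁₂ P₂₃ Y
    on-ℓ₃ : StrictlyBetween P₂₃ P₃₄ X
    on-ℓ₄ : StrictlyBetween P₄₁ P₃₄ Y

  -- Sides of the quadrilateral P₁₂ P₂₃ P₃₄ P₄₁, given by their endpoints.
  A : Fin 4 → Point × Point
  A 0F = P₄₁ , P₁₂
  A 1F = P₁₂ , P₂₃
  A 2F = P₂₃ , P₃₄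
  A 3F = P₃₄ , P₄₁

  -- B 0F and B 2F, with A 3F, are the sides of the triangle P₄₁ P₃₄ X;
  -- B 1F and B 3F, with A 2F, are the sides of the triangle P₃₄ P₂₃ Y.
  B : Fin 4 → Point × Point
  B 0F = P₄₁ , X
  B 1F = P₂₃ , Y
  B 2F = P₃₄ , X
  B 3F = P₃₄ , Y

record HasRatios (S : Fin 4 → Segment) (b : Fin 4 → ℝ) : Set where
  field
    labelling : Labelling S
    a         : Fin 4 → ℝ

  open Labelling labelling

  field
    a>0      : ∀ i → 0ℝ < a i
    b>0      : ∀ i → 0ℝ < b i
    length-A : ∀ i → IsLength (a i) (A i)
    length-B : ∀ i → IsLength (b i * a i) (B i)

{-# OPTIONS --safe #-}

-- If the common end of Aᵢ and Bᵢ divides Aᵢ ∪ Bᵢ in the ratio tᵢ : 1 - tᵢ,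
-- the lengths give bᵢ tᵢ = 1 - tᵢ. Evaluating affine equations of ℓ₁ and ℓ₂
-- at P₃₄, which lies on both ℓ₃ and ℓ₄, gives t₄ = (1 - t₃) t₂ and
-- t₃ = (1 - t₄) t₁, and eliminating the tᵢ gives the two relations. By Helly's
-- theorem on a line no intersection point lies on the line of a third segment; hence
-- the affine equation of the fourth line has distinct nonzero values at the
-- vertices of the triangle of the other three, and their signs and order
-- determine a labelling.
module Submission where

open import Defs
open import Algebra.Bundles using (CommutativeMonoid; CommutativeRing)
import Algebra.Solver.Ring as RingSolver
open import Algebra.Solver.Ring.AlmostCommutativeRing
  using (AlmostCommutativeRing; fromCommutativeRing; _-Raw-AlmostCommutative⟶_)
open import Axiom.ExcludedMiddle using (ExcludedMiddle)
open import Data.Empty using (⊥)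
open import Data.Fin.Base using (Fin)
open import Data.Fin.Patterns using (0F; 1F; 2F; 3F)
open import Data.Fin.Permutation using (Permutation′; _⟨$⟩ʳ_; transpose; _∘ₚ_)
open import Data.Maybe.Base using (Maybe; just; nothing)
open import Data.Nat.Base as ℕ using (ℕ)
import Data.Nat.Properties as ℕ
open import Data.Product.Base using (_×_; _,_; proj₁; proj₂; swap; ∃-syntax; Σ-syntax)
open import Data.Rational.Base as ℚ using (ℚ; 0ℚ; 1ℚ; ½; ∣_∣)
import Data.Rational.Properties as ℚ
open import Data.Rational.Solver using (module +-*-Solver)
open import Data.Sum.Base using (_⊎_; inj₁; inj₂; [_,_]′)
open import Function.Base using (case_of_; _∘_)
open import Function.Bundles using (Injection)
open import Function.Properties.Inverse using (↔⇒↣)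
open import Level using (0ℓ)
open import Relation.Binary.Bundles using (Setoid)
open import Relation.Binary.PropositionalEquality
  using (_≡_; _≢_; refl; sym; trans; cong; cong₂; subst; module ≡-Reasoning)
open import Relation.Nullary.Decidable.Core using (yes; no)
open import Relation.Nullary.Negation using (¬_; contradiction)

-- Neither equality nor sign is decidable for Cauchy reals. Equality is nevertheless stable under
-- double negation (`antisym`), so a goal of the form `x ≃ y`, or a contradiction, may be proved by
-- cases on the signs of reals. The two relations need only such goals and stay constructive,
-- including their use of Helly's theorem. A labelling is data, and choosing one means deciding
-- signs; this is where excluded middle enters.
--
-- The sign patterns are fewer than they seem. After permuting the three sides of the triangle, and
-- replacing the affine function by its negative where needed, its values at the vertices satisfy a
-- < b < c with either 0 < a, when the fourth line misses the triangle, or a < 0 < b, when it cuts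
-- off the vertex A.

module CauchySequences where
  open +-*-Solver

  -- Estimates for rational numbers

  half-pos : ∀ {ε} → 0ℚ ℚ.< ε → 0ℚ ℚ.< ½ ℚ.* ε
  half-pos {ε} ε>0 = subst (ℚ._< ½ ℚ.* ε) (ℚ.*-zeroʳ ½) (ℚ.*-monoʳ-<-pos ½ ε>0)

  halves : ∀ ε → ½ ℚ.* ε ℚ.+ ½ ℚ.* ε ≡ ε
  halves = solve 1 (λ ε → con ½ :* ε :+ con ½ :* ε := ε) refl

  *-pos : ∀ {p q} → 0ℚ ℚ.< p → 0ℚ ℚ.< q → 0ℚ ℚ.< p ℚ.* q
  *-pos {p} {q} p>0 q>0 =
    ℚ.positive⁻¹ _ {{ℚ.pos*pos⇒pos p {{ℚ.positive p>0}} q {{ℚ.positive q>0}}}}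

  p≤∣p∣ : ∀ p → p ℚ.≤ ∣ p ∣
  p≤∣p∣ p with ℚ.≤-total 0ℚ p
  ... | inj₁ 0≤p = ℚ.≤-reflexive (sym (ℚ.0≤p⇒∣p∣≡p 0≤p))
  ... | inj₂ p≤0 = ℚ.≤-trans p≤0 (ℚ.0≤∣p∣ p)

  ∣+∣<ε : ∀ {ε} p q → ∣ p ∣ ℚ.< ½ ℚ.* ε → ∣ q ∣ ℚ.< ½ ℚ.* ε → ∣ p ℚ.+ q ∣ ℚ.< ε
  ∣+∣<ε {ε} p q p<ε q<ε = begin-strict
    ∣ p ℚ.+ q ∣          ≤⟨ ℚ.∣p+q∣≤∣p∣+∣q∣ p q ⟩
    ∣ p ∣ ℚ.+ ∣ q ∣      <⟨ ℚ.+-mono-< p<ε q<ε ⟩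
    ½ ℚ.* ε ℚ.+ ½ ℚ.* ε  ≡⟨ halves ε ⟩
    ε                    ∎
    where open ℚ.≤-Reasoning

  ∣p-q∣≡∣q-p∣ : ∀ p q → ∣ p ℚ.- q ∣ ≡ ∣ q ℚ.- p ∣
  ∣p-q∣≡∣q-p∣ p q = trans (sym (ℚ.∣-p∣≡∣p∣ (p ℚ.- q)))
    (cong ∣_∣ (solve 2 (λ p q → :- (p :- q) := q :- p) refl p q))

  close⇒≥ : ∀ {p q ε} → ∣ p ℚ.- q ∣ ℚ.< ½ ℚ.* ε → ε ℚ.≤ p → ½ ℚ.* ε ℚ.≤ q
  close⇒≥ {p} {q} {ε} close ε≤p = begin
    ½ ℚ.* ε              ≡⟨ solve 1 (λ ε → con ½ :* ε := ε :- con ½ :* ε) refl ε ⟩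
    ε ℚ.- ½ ℚ.* ε        ≤⟨ ℚ.+-mono-≤ ε≤p (ℚ.neg-antimono-≤
                              (ℚ.≤-trans (p≤∣p∣ (p ℚ.- q)) (ℚ.<⇒≤ close))) ⟩
    p ℚ.- (p ℚ.- q)      ≡⟨ solve 2 (λ p q → p :- (p :- q) := q) refl p q ⟩
    q                    ∎
    where open ℚ.≤-Reasoning

  -- The value at 0 is irrelevant.
  recip : ℚ → ℚ
  recip p with p ℚ.≟ 0ℚ
  ... | yes _  = 0ℚ
  ... | no p≢0 = (ℚ.1/ p) {{ℚ.≢-nonZero p≢0}}

  *-recip : ∀ {p} → p ≢ 0ℚ → p ℚ.* recip p ≡ 1ℚ
  *-recip {p} p≢0 with p ℚ.≟ 0ℚ
  ... | yes p≡0 = contradiction p≡0 p≢0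
  ... | no p≢0′ = ℚ.*-inverseʳ p {{ℚ.≢-nonZero p≢0′}}

  pos⇒≢0 : ∀ {p} → 0ℚ ℚ.< p → p ≢ 0ℚ
  pos⇒≢0 p>0 p≡0 = ℚ.<⇒≢ p>0 (sym p≡0)

  recip-pos : ∀ {p} → 0ℚ ℚ.< p → 0ℚ ℚ.< recip p
  recip-pos {p} p>0 with p ℚ.≟ 0ℚ
  ... | yes p≡0 = contradiction p≡0 (pos⇒≢0 p>0)
  ... | no p≢0  = ℚ.positive⁻¹ _ {{ℚ.1/pos⇒pos p {{ℚ.positive p>0}}}}

  recip-antimono : ∀ {p q} → 0ℚ ℚ.< p → p ℚ.≤ q → recip q ℚ.≤ recip p
  recip-antimono {p} {q} p>0 p≤q = begin
    recip q                      ≡⟨ sym (ℚ.*-identityʳ (recip q)) ⟩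
    recip q ℚ.* 1ℚ               ≡⟨ cong (recip q ℚ.*_) (sym (*-recip (pos⇒≢0 p>0))) ⟩
    recip q ℚ.* (p ℚ.* recip p)  ≤⟨ ℚ.*-monoˡ-≤-nonNeg (recip q) {{nonNeg-recip q>0}}
                                      (ℚ.*-monoʳ-≤-nonNeg (recip p) {{nonNeg-recip p>0}} p≤q) ⟩
    recip q ℚ.* (q ℚ.* recip p)  ≡⟨ solve 3 (λ r q s → r :* (q :* s) := q :* r :* s) refl (recip q) q (recip p) ⟩
    q ℚ.* recip q ℚ.* recip p    ≡⟨ cong (ℚ._* recip p) (*-recip (pos⇒≢0 q>0)) ⟩
    1ℚ ℚ.* recip p               ≡⟨ ℚ.*-identityˡ (recip p) ⟩
    recip p                      ∎
    where
    open ℚ.≤-Reasoning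
    q>0 = ℚ.<-≤-trans p>0 p≤q
    nonNeg-recip : ∀ {r} → 0ℚ ℚ.< r → ℚ.NonNegative (recip r)
    nonNeg-recip r>0 = ℚ.nonNegative (ℚ.<⇒≤ (recip-pos r>0))

  -- _≈_, _<_ and _≤_ only see the sequences of their arguments, from which Agda
  -- cannot recover the reals themselves; wrapping them in records lets it.

  infix 4 _≃_

  record _≃_ (x y : ℝ) : Set where
    constructor wrap
    field unwrap : x ≈ y

  record NonNeg (x : ℝ) : Set where
    constructor wrap
    field unwrap : 0ℝ ≤ x

  record Pos (x : ℝ) : Set where
    constructor wrap
    field unwrap : 0ℝ < x

  open _≃_ public
  open Pos public
  open NonNeg public

  -- Equality of Cauchy reals and the ring laws

  Eventually : (ℕ → Set) → Set
  Eventually P = ∃[ N ] ∀ n → N ℕ.≤ n → P n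

  eventually₂ : ∀ {P Q R : ℕ → Set} → (∀ n → P n → Q n → R n) →
    Eventually P → Eventually Q → Eventually R
  eventually₂ f (M , p) (N , q) = M ℕ.⊔ N , λ n K≤n →
    f n (p n (ℕ.m⊔n≤o⇒m≤o M N K≤n)) (q n (ℕ.m⊔n≤o⇒n≤o M N K≤n))

  eventually-≡⇒≃ : ∀ {x y} → Eventually (λ n → seq x n ≡ seq y n) → x ≃ y
  eventually-≡⇒≃ {x} {y} (N , eq) = wrap λ ε ε>0 → N , λ n N≤n → subst (ℚ._< ε)
    (sym (cong ∣_∣ (trans (cong (ℚ._- seq y n) (eq n N≤n)) (ℚ.+-inverseʳ (seq y n))))) ε>0

  pointwise : ∀ {x y} → (∀ n → seq x n ≡ seq y n) → x ≃ y
  pointwise eq = eventually-≡⇒≃ (0 , λ n _ → eq n)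

  eventually-bounded : ∀ x → ∃[ B ] (0ℚ ℚ.< B) × Eventually (λ n → ∣ seq x n ∣ ℚ.≤ B)
  eventually-bounded x =
    let N , close = cauchy x 1ℚ (ℚ.positive⁻¹ 1ℚ) in
    1ℚ ℚ.+ ∣ seq x N ∣ , ℚ.+-mono-<-≤ (ℚ.positive⁻¹ 1ℚ) (ℚ.0≤∣p∣ (seq x N)) , N , λ n N≤n → begin
    ∣ seq x n ∣                              ≡⟨ cong ∣_∣ (solve 2 (λ p q → p := (p :- q) :+ q) refl (seq x n) (seq x N)) ⟩
    ∣ (seq x n ℚ.- seq x N) ℚ.+ seq x N ∣    ≤⟨ ℚ.∣p+q∣≤∣p∣+∣q∣ (seq x n ℚ.- seq x N) (seq x N) ⟩
    ∣ seq x n ℚ.- seq x N ∣ ℚ.+ ∣ seq x N ∣  ≤⟨ ℚ.+-monoˡ-≤ ∣ seq x N ∣ (ℚ.<⇒≤ (close n N N≤n ℕ.≤-refl)) ⟩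
    1ℚ ℚ.+ ∣ seq x N ∣                       ∎
    where open ℚ.≤-Reasoning

  small : ∀ {x} → x ≃ 0ℝ → ∀ ε → 0ℚ ℚ.< ε → Eventually (λ n → ∣ seq x n ∣ ℚ.< ε)
  small {x} x≃0 ε ε>0 = let N , f = unwrap x≃0 ε ε>0 in
    N , λ n N≤n → subst (ℚ._< ε) (cong ∣_∣ (ℚ.+-identityʳ (seq x n))) (f n N≤n)

  small⁻¹ : ∀ {x} → (∀ ε → 0ℚ ℚ.< ε → Eventually (λ n → ∣ seq x n ∣ ℚ.< ε)) → x ≃ 0ℝ
  small⁻¹ {x} f = wrap λ ε ε>0 → let N , g = f ε ε>0 in
    N , λ n N≤n → subst (ℚ._< ε) (sym (cong ∣_∣ (ℚ.+-identityʳ (seq x n)))) (g n N≤n)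

  by-terms : ∀ {x y z} → z ≃ 0ℝ → (∀ n → seq x n ℚ.- seq y n ≡ seq z n) → x ≃ y
  by-terms z≃0 eq = wrap λ ε ε>0 → let N , f = small z≃0 ε ε>0 in
    N , λ n N≤n → subst (ℚ._< ε) (cong ∣_∣ (sym (eq n))) (f n N≤n)

  ≃-refl : ∀ {x} → x ≃ x
  ≃-refl = pointwise λ _ → refl

  ≃-sym : ∀ {x y} → x ≃ y → y ≃ x
  ≃-sym {x} {y} x≃y = wrap λ ε ε>0 → let N , f = unwrap x≃y ε ε>0 in
    N , λ n N≤n → subst (ℚ._< ε) (∣p-q∣≡∣q-p∣ (seq x n) (seq y n)) (f n N≤n)

  ≃-trans : ∀ {x y z} → x ≃ y → y ≃ z → x ≃ z
  ≃-trans {x} {y} {z} x≃y y≃z = wrap λ ε ε>0 → eventually₂ (λ n x≃y y≃z → begin-strict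
    ∣ seq x n ℚ.- seq z n ∣
      ≡⟨ cong ∣_∣ (solve 3 (λ x y z → x :- z := (x :- y) :+ (y :- z)) refl (seq x n) (seq y n) (seq z n)) ⟩
    ∣ (seq x n ℚ.- seq y n) ℚ.+ (seq y n ℚ.- seq z n) ∣
      <⟨ ∣+∣<ε (seq x n ℚ.- seq y n) (seq y n ℚ.- seq z n) x≃y y≃z ⟩
    ε ∎) (unwrap x≃y (½ ℚ.* ε) (half-pos ε>0)) (unwrap y≃z (½ ℚ.* ε) (half-pos ε>0))
    where open ℚ.≤-Reasoning

  -- Copies of the operations that do not unfold: a real carries its Cauchy
  -- proof, which makes comparing unfolded terms prohibitively slow.

  infixl 6 _⊕_ _⊝_
  infixl 7 _⊗_
  infix  8 ⊖_

  opaque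
    _⊕_ _⊗_ : ℝ → ℝ → ℝ
    _⊕_ = _+_
    _⊗_ = _*_

    ⊖_ : ℝ → ℝ
    ⊖_ = -_

  _⊝_ : ℝ → ℝ → ℝ
  x ⊝ y = x ⊕ ⊖ y

  opaque
    unfolding _⊕_

    ⊗-≃0 : ∀ c {x} → x ≃ 0ℝ → c ⊗ x ≃ 0ℝ
    ⊗-≃0 c {x} x≃0 = small⁻¹ λ ε ε>0 →
      let B , B>0 , bound = eventually-bounded c
          δ               = recip B ℚ.* ε
      in eventually₂ (λ n c≤B x<δ → begin-strict
      ∣ seq c n ℚ.* seq x n ∣      ≡⟨ ℚ.∣p*q∣≡∣p∣*∣q∣ (seq c n) (seq x n) ⟩
      ∣ seq c n ∣ ℚ.* ∣ seq x n ∣  ≤⟨ ℚ.*-monoʳ-≤-nonNeg ∣ seq x n ∣ {{ℚ.∣-∣-nonNeg (seq x n)}} c≤B ⟩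
      B ℚ.* ∣ seq x n ∣            <⟨ ℚ.*-monoʳ-<-pos B {{ℚ.positive B>0}} x<δ ⟩
      B ℚ.* (recip B ℚ.* ε)        ≡⟨ sym (ℚ.*-assoc B (recip B) ε) ⟩
      B ℚ.* recip B ℚ.* ε          ≡⟨ cong (ℚ._* ε) (*-recip (pos⇒≢0 B>0)) ⟩
      1ℚ ℚ.* ε                     ≡⟨ ℚ.*-identityˡ ε ⟩
      ε                            ∎)
      bound (small x≃0 δ (*-pos (recip-pos B>0) ε>0))
      where open ℚ.≤-Reasoning

    ⊕-≃0 : ∀ {x y} → x ≃ 0ℝ → y ≃ 0ℝ → x ⊕ y ≃ 0ℝ
    ⊕-≃0 {x} {y} x≃0 y≃0 = small⁻¹ λ ε ε>0 → eventually₂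
      (λ n → ∣+∣<ε (seq x n) (seq y n))
      (small x≃0 (½ ℚ.* ε) (half-pos ε>0)) (small y≃0 (½ ℚ.* ε) (half-pos ε>0))

    difference : ∀ {x y} → x ≃ y → x ⊝ y ≃ 0ℝ
    difference x≃y = small⁻¹ (unwrap x≃y)

    difference⁻¹ : ∀ {x y} → x ⊝ y ≃ 0ℝ → x ≃ y
    difference⁻¹ x⊝y≃0 = by-terms x⊝y≃0 λ _ → refl

    ⊕-cong : ∀ {x x′ y y′} → x ≃ x′ → y ≃ y′ → x ⊕ y ≃ x′ ⊕ y′
    ⊕-cong {x} {x′} {y} {y′} x≃x′ y≃y′ =
      by-terms (⊕-≃0 (difference x≃x′) (difference y≃y′)) λ n → solve 4
        (λ x x′ y y′ → x :+ y :- (x′ :+ y′) := (x :- x′) :+ (y :- y′)) refl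
        (seq x n) (seq x′ n) (seq y n) (seq y′ n)

    ⊗-cong : ∀ {x x′ y y′} → x ≃ x′ → y ≃ y′ → x ⊗ y ≃ x′ ⊗ y′
    ⊗-cong {x} {x′} {y} {y′} x≃x′ y≃y′ =
      by-terms (⊕-≃0 (⊗-≃0 y (difference x≃x′)) (⊗-≃0 x′ (difference y≃y′))) λ n → solve 4
        (λ x x′ y y′ → x :* y :- x′ :* y′ := y :* (x :- x′) :+ x′ :* (y :- y′)) refl
        (seq x n) (seq x′ n) (seq y n) (seq y′ n)

    ⊖-cong : ∀ {x y} → x ≃ y → ⊖ x ≃ ⊖ y
    ⊖-cong {x} {y} x≃y = ≃-sym (by-terms (difference x≃y) λ n →
      solve 2 (λ x y → :- y :- :- x := x :- y) refl (seq x n) (seq y n))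

    ⊕-assoc : ∀ x y z → (x ⊕ y) ⊕ z ≃ x ⊕ (y ⊕ z)
    ⊕-assoc x y z = pointwise λ n → ℚ.+-assoc (seq x n) (seq y n) (seq z n)

    ⊕-comm : ∀ x y → x ⊕ y ≃ y ⊕ x
    ⊕-comm x y = pointwise λ n → ℚ.+-comm (seq x n) (seq y n)

    ⊕-identityˡ : ∀ x → 0ℝ ⊕ x ≃ x
    ⊕-identityˡ x = pointwise λ n → ℚ.+-identityˡ (seq x n)

    ⊖-inverseˡ : ∀ x → ⊖ x ⊕ x ≃ 0ℝ
    ⊖-inverseˡ x = pointwise λ n → ℚ.+-inverseˡ (seq x n)

    ⊗-assoc : ∀ x y z → (x ⊗ y) ⊗ z ≃ x ⊗ (y ⊗ z)
    ⊗-assoc x y z = pointwise λ n → ℚ.*-assoc (seq x n) (seq y n) (seq z n)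

    ⊗-comm : ∀ x y → x ⊗ y ≃ y ⊗ x
    ⊗-comm x y = pointwise λ n → ℚ.*-comm (seq x n) (seq y n)

    ⊗-identityˡ : ∀ x → 1ℝ ⊗ x ≃ x
    ⊗-identityˡ x = pointwise λ n → ℚ.*-identityˡ (seq x n)

    ⊗-distribˡ-⊕ : ∀ x y z → x ⊗ (y ⊕ z) ≃ x ⊗ y ⊕ x ⊗ z
    ⊗-distribˡ-⊕ x y z = pointwise λ n → ℚ.*-distribˡ-+ (seq x n) (seq y n) (seq z n)

    fromℚ-+ : ∀ p q → fromℚ (p ℚ.+ q) ≃ fromℚ p ⊕ fromℚ q
    fromℚ-+ p q = pointwise λ _ → refl

    fromℚ-* : ∀ p q → fromℚ (p ℚ.* q) ≃ fromℚ p ⊗ fromℚ q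
    fromℚ-* p q = pointwise λ _ → refl

    fromℚ-neg : ∀ p → fromℚ (ℚ.- p) ≃ ⊖ fromℚ p
    fromℚ-neg p = pointwise λ _ → refl

  -- Order and reciprocals of Cauchy reals

  bounded-below⇒pos : ∀ {x ε} → 0ℚ ℚ.< ε → Eventually (λ n → ε ℚ.≤ seq x n) → Pos x
  bounded-below⇒pos {x} {ε} ε>0 (N , f) = wrap
    (ε , ε>0 , N , λ n N≤n → subst (ℚ._≤ seq x n) (sym (ℚ.+-identityˡ ε)) (f n N≤n))

  pos⇒bounded-below : ∀ {x} → Pos x → ∃[ ε ] (0ℚ ℚ.< ε) × Eventually (λ n → ε ℚ.≤ seq x n)
  pos⇒bounded-below {x} (wrap (ε , ε>0 , N , f)) =
    ε , ε>0 , N , λ n N≤n → subst (ℚ._≤ seq x n) (ℚ.+-identityˡ ε) (f n N≤n)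

  Pos-resp-≃ : ∀ {x y} → x ≃ y → Pos x → Pos y
  Pos-resp-≃ x≃y x>0 =
    let ε , ε>0 , x≥ε = pos⇒bounded-below x>0 in
    bounded-below⇒pos (half-pos ε>0)
      (eventually₂ (λ n x≥ε close → close⇒≥ close x≥ε) x≥ε (unwrap x≃y (½ ℚ.* ε) (half-pos ε>0)))

  opaque
    unfolding _⊕_

    Pos-+ : ∀ {x y} → Pos x → Pos y → Pos (x ⊕ y)
    Pos-+ x>0 y>0 =
      let ε , ε>0 , x≥ε = pos⇒bounded-below x>0
          δ , δ>0 , y≥δ = pos⇒bounded-below y>0
      in bounded-below⇒pos (ℚ.+-mono-< ε>0 δ>0) (eventually₂ (λ n → ℚ.+-mono-≤) x≥ε y≥δ)

    Pos-* : ∀ {x y} → Pos x → Pos y → Pos (x ⊗ y)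
    Pos-* x>0 y>0 =
      let ε , ε>0 , x≥ε = pos⇒bounded-below x>0
          δ , δ>0 , y≥δ = pos⇒bounded-below y>0
      in bounded-below⇒pos (*-pos ε>0 δ>0) (eventually₂ (λ n x≥ε y≥δ → ℚ.≤-trans
          (ℚ.*-monoˡ-≤-nonNeg ε {{ℚ.nonNegative (ℚ.<⇒≤ ε>0)}} y≥δ)
          (ℚ.*-monoʳ-≤-nonNeg _ {{ℚ.nonNegative (ℚ.≤-trans (ℚ.<⇒≤ δ>0) y≥δ)}} x≥ε)) x≥ε y≥δ)

    <⇒Pos : ∀ {x y} → x < y → Pos (y ⊝ x)
    <⇒Pos {x} {y} (ε , ε>0 , N , f) = bounded-below⇒pos ε>0 (N , λ n N≤n → begin
      ε                                ≡⟨ solve 2 (λ x ε → ε := x :+ ε :- x) refl (seq x n) ε ⟩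
      seq x n ℚ.+ ε ℚ.- seq x n        ≤⟨ ℚ.+-monoˡ-≤ (ℚ.- seq x n) (f n N≤n) ⟩
      seq y n ℚ.- seq x n              ∎)
      where open ℚ.≤-Reasoning

    Pos⇒< : ∀ {x y} → Pos (y ⊝ x) → x < y
    Pos⇒< {x} {y} y-x>0 = let ε , ε>0 , N , f = pos⇒bounded-below y-x>0 in
      ε , ε>0 , N , λ n N≤n → begin
      seq x n ℚ.+ ε                         ≤⟨ ℚ.+-monoʳ-≤ (seq x n) (f n N≤n) ⟩
      seq x n ℚ.+ (seq y n ℚ.- seq x n)     ≡⟨ solve 2 (λ x y → x :+ (y :- x) := y) refl (seq x n) (seq y n) ⟩
      seq y n                               ∎
      where open ℚ.≤-Reasoning

    -- A single late term of size at least ε keeps every term from N on above ε/2. The index N is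
    -- chosen before the term is inspected, so one N serves all terms.
    cauchy⇒pos : ∀ x ε → 0ℚ ℚ.< ε → Eventually (λ n → ε ℚ.≤ seq x n → Pos x)
    cauchy⇒pos x ε ε>0 = let N , close = cauchy x (½ ℚ.* ε) (half-pos ε>0) in
      N , λ n N≤n ε≤x → bounded-below⇒pos (half-pos ε>0)
        (N , λ m N≤m → close⇒≥ (close n m N≤n N≤m) ε≤x)

    -- Rationals can be compared, so no case distinction on reals is needed: a late term of absolute
    -- value at least ε would, by `cauchy⇒pos`, give `x` or `⊖ x` a positive lower bound.
    antisym : ∀ {x} → ¬ Pos x → ¬ Pos (⊖ x) → x ≃ 0ℝ
    antisym {x} x≯0 x≮0 = small⁻¹ λ ε ε>0 → eventually₂ (λ n f g → ℚ.≰⇒> λ ε≤∣x∣ →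
        case ℚ.∣p∣≡p∨∣p∣≡-p (seq x n) of λ
          { (inj₁ eq) → x≯0 (f (subst (ε ℚ.≤_) eq ε≤∣x∣))
          ; (inj₂ eq) → x≮0 (g (subst (ε ℚ.≤_) eq ε≤∣x∣)) })
      (cauchy⇒pos x ε ε>0) (cauchy⇒pos (⊖ x) ε ε>0)

  -- 1/p - 1/q = (q - p)/(pq) and pq is at least ε², whence the tolerance ε²δ.
  recip-near : ∀ {p q ε δ} → 0ℚ ℚ.< ε → ε ℚ.≤ p → ε ℚ.≤ q →
    ∣ q ℚ.- p ∣ ℚ.< ε ℚ.* ε ℚ.* δ → ∣ recip p ℚ.- recip q ∣ ℚ.< δ
  recip-near {p} {q} {ε} {δ} ε>0 ε≤p ε≤q close = begin-strict
    ∣ recip p ℚ.- recip q ∣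
      ≡⟨ cong ∣_∣ (reciprocals (recip p) (recip q) (*-recip (pos⇒≢0 p>0)) (*-recip (pos⇒≢0 q>0))) ⟩
    ∣ recip p ℚ.* recip q ℚ.* (q ℚ.- p) ∣
      ≡⟨ ℚ.∣p*q∣≡∣p∣*∣q∣ (recip p ℚ.* recip q) (q ℚ.- p) ⟩
    ∣ recip p ℚ.* recip q ∣ ℚ.* ∣ q ℚ.- p ∣
      ≡⟨ cong (ℚ._* ∣ q ℚ.- p ∣) (ℚ.0≤p⇒∣p∣≡p (ℚ.<⇒≤ (*-pos (recip-pos p>0) (recip-pos q>0)))) ⟩
    recip p ℚ.* recip q ℚ.* ∣ q ℚ.- p ∣
      ≤⟨ ℚ.*-monoʳ-≤-nonNeg ∣ q ℚ.- p ∣ {{ℚ.∣-∣-nonNeg (q ℚ.- p)}} (ℚ.≤-trans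
           (ℚ.*-monoʳ-≤-nonNeg (recip q) {{ℚ.nonNegative (ℚ.<⇒≤ (recip-pos q>0))}} (recip-antimono ε>0 ε≤p))
           (ℚ.*-monoˡ-≤-nonNeg (recip ε) {{ℚ.nonNegative (ℚ.<⇒≤ r>0)}} (recip-antimono ε>0 ε≤q))) ⟩
    recip ε ℚ.* recip ε ℚ.* ∣ q ℚ.- p ∣
      <⟨ ℚ.*-monoʳ-<-pos (recip ε ℚ.* recip ε) {{ℚ.positive (*-pos r>0 r>0)}} close ⟩
    recip ε ℚ.* recip ε ℚ.* (ε ℚ.* ε ℚ.* δ)
      ≡⟨ solve 3 (λ r ε δ → r :* r :* (ε :* ε :* δ) := (ε :* r) :* ((ε :* r) :* δ)) refl (recip ε) ε δ ⟩
    (ε ℚ.* recip ε) ℚ.* ((ε ℚ.* recip ε) ℚ.* δ)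
      ≡⟨ cong (λ u → u ℚ.* (u ℚ.* δ)) (*-recip (pos⇒≢0 ε>0)) ⟩
    1ℚ ℚ.* (1ℚ ℚ.* δ)
      ≡⟨ trans (ℚ.*-identityˡ _) (ℚ.*-identityˡ δ) ⟩
    δ ∎
    where
    open ℚ.≤-Reasoning
    p>0 = ℚ.<-≤-trans ε>0 ε≤p
    q>0 = ℚ.<-≤-trans ε>0 ε≤q
    r>0 = recip-pos ε>0
    reciprocals : ∀ r s → p ℚ.* r ≡ 1ℚ → q ℚ.* s ≡ 1ℚ → r ℚ.- s ≡ r ℚ.* s ℚ.* (q ℚ.- p)
    reciprocals r s pr≡1 qs≡1 = trans
      (sym (cong₂ ℚ._-_ (trans (cong (r ℚ.*_) qs≡1) (ℚ.*-identityʳ r))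
                        (trans (cong (s ℚ.*_) pr≡1) (ℚ.*-identityʳ s))))
      (solve 4 (λ p q r s → r :* (q :* s) :- s :* (p :* r) := r :* s :* (q :- p)) refl p q r s)

  opaque
    unfolding _⊕_

    inverse : ∀ {x} → Pos x → ∃[ y ] Pos y × x ⊗ y ≃ 1ℝ
    inverse {x} x>0 =
      let ε , ε>0 , N , x≥ε     = pos⇒bounded-below x>0
          B , B>0 , bound       = eventually-bounded x
          -- Early terms of `x` may be 0, where `recip` takes its default value; all estimates start
          -- at N, beyond which the terms are at least ε.
          y = mkℝ (λ n → recip (seq x n)) λ δ δ>0 →
            let M , close = cauchy x (ε ℚ.* ε ℚ.* δ) (*-pos (*-pos ε>0 ε>0) δ>0) in
            M ℕ.⊔ N , λ m n K≤m K≤n → recip-near ε>0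
              (x≥ε m (ℕ.m⊔n≤o⇒n≤o M N K≤m)) (x≥ε n (ℕ.m⊔n≤o⇒n≤o M N K≤n))
              (close n m (ℕ.m⊔n≤o⇒m≤o M N K≤n) (ℕ.m⊔n≤o⇒m≤o M N K≤m))
      in y
       , bounded-below⇒pos (recip-pos B>0) (eventually₂ (λ n x≥ε ∣x∣≤B →
           recip-antimono (ℚ.<-≤-trans ε>0 x≥ε) (ℚ.≤-trans (p≤∣p∣ (seq x n)) ∣x∣≤B)) (N , x≥ε) bound)
       , eventually-≡⇒≃ (N , λ n N≤n → *-recip (pos⇒≢0 (ℚ.<-≤-trans ε>0 (x≥ε n N≤n))))

  nonNeg : ∀ {x} → ¬ Pos (⊖ x) → NonNeg x
  nonNeg {x} x≮0 = wrap λ x<0 → x≮0 (Pos-resp-≃ (⊕-identityˡ (⊖ x)) (<⇒Pos x<0))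

  nonNeg⁻¹ : ∀ {x} → NonNeg x → ¬ Pos (⊖ x)
  nonNeg⁻¹ {x} (wrap x≥0) -x>0 = x≥0 (Pos⇒< (Pos-resp-≃ (≃-sym (⊕-identityˡ (⊖ x))) -x>0))

  opaque
    unfolding _⊕_

    -- Nonnegativity is only a negation, yet by `cauchy⇒pos` it keeps the late terms of `y` above -η
    -- for each rational η > 0. The choice η = ε/2 spends half of the gap of `x`.
    Pos+NonNeg : ∀ {x y} → Pos x → NonNeg y → Pos (x ⊕ y)
    Pos+NonNeg {x} {y} x>0 y≥0 =
      let ε , ε>0 , x≥ε = pos⇒bounded-below x>0 in
      bounded-below⇒pos (half-pos ε>0) (eventually₂ (λ n x≥ε f → begin
        ½ ℚ.* ε                    ≡⟨ solve 1 (λ ε → con ½ :* ε := ε :- con ½ :* ε) refl ε ⟩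
        ε ℚ.- ½ ℚ.* ε              ≤⟨ ℚ.+-mono-≤ x≥ε (ℚ.neg-antimono-≤ (ℚ.<⇒≤ (ℚ.≰⇒> (nonNeg⁻¹ y≥0 ∘ f)))) ⟩
        seq x n ℚ.- (ℚ.- seq y n)  ≡⟨ solve 2 (λ x y → x :- :- y := x :+ y) refl (seq x n) (seq y n) ⟩
        seq x n ℚ.+ seq y n        ∎)
      x≥ε (cauchy⇒pos (⊖ y) (½ ℚ.* ε) (half-pos ε>0)))
      where open ℚ.≤-Reasoning

open CauchySequences public

-- Polynomial identities over the reals

≃-setoid : Setoid 0ℓ 0ℓ
≃-setoid = record
  { Carrier = ℝ ; _≈_ = _≃_
  ; isEquivalence = record { refl = ≃-refl ; sym = ≃-sym ; trans = ≃-trans } }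

⊕-⊗-commutativeRing : CommutativeRing 0ℓ 0ℓ
⊕-⊗-commutativeRing = record
  { Carrier = ℝ ; _≈_ = _≃_ ; _+_ = _⊕_ ; _*_ = _⊗_ ; -_ = ⊖_ ; 0# = 0ℝ ; 1# = 1ℝ
  ; isCommutativeRing = record
    { isRing = record
      { +-isAbelianGroup = record
        { isGroup = record
          { isMonoid = record
            { isSemigroup = record
              { isMagma = record { isEquivalence = Setoid.isEquivalence ≃-setoid ; ∙-cong = ⊕-cong }
              ; assoc = ⊕-assoc }
            ; identity = comm∧idˡ⇒id ⊕-comm ⊕-identityˡ }
          ; inverse = comm∧invˡ⇒inv ⊕-comm ⊖-inverseˡ
          ; ⁻¹-cong = ⊖-cong }
        ; comm = ⊕-comm }
      ; *-cong = ⊗-cong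
      ; *-assoc = ⊗-assoc
      ; *-identity = comm∧idˡ⇒id ⊗-comm ⊗-identityˡ
      ; distrib = comm∧distrˡ⇒distr ⊕-cong ⊗-comm ⊗-distribˡ-⊕ }
    ; *-comm = ⊗-comm } }
  where open import Algebra.Consequences.Setoid ≃-setoid

ℝ-ring : AlmostCommutativeRing 0ℓ 0ℓ
ℝ-ring = fromCommutativeRing ⊕-⊗-commutativeRing

-- The solver must recognise equal coefficients, which is possible for rationals but not for
-- arbitrary reals.
fromℚ-morphism : ℚ.+-*-rawRing -Raw-AlmostCommutative⟶ ℝ-ring
fromℚ-morphism = record
  { ⟦_⟧ = fromℚ ; +-homo = fromℚ-+ ; *-homo = fromℚ-* ; -‿homo = fromℚ-neg
  ; 0-homo = ≃-refl ; 1-homo = ≃-refl }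

fromℚ-≟ : ∀ p q → Maybe (fromℚ p ≃ fromℚ q)
fromℚ-≟ p q with p ℚ.≟ q
... | yes refl = just ≃-refl
... | no _     = nothing

module ℝ-Solver = RingSolver ℚ.+-*-rawRing ℝ-ring fromℚ-morphism fromℚ-≟

open ℝ-Solver using (Polynomial; con; _:+_; _:*_; _:-_; :-_; _:=_; solve)

0ₚ 1ₚ : ∀ {n} → Polynomial n
0ₚ = con 0ℚ
1ₚ = con 1ℚ

-- A linear combination of equations x ≃ y is recorded as c ⊗ (x ⊝ y) ⊕ ⋯ ≃ 0ℝ.

infixr 4 _⊞_
infix 5 _·_

_·_ : ∀ c {x y} → x ≃ y → c ⊗ (x ⊝ y) ≃ 0ℝ
c · x≃y = ⊗-≃0 c (difference x≃y)

_⊞_ : ∀ {x y} → x ≃ 0ℝ → y ≃ 0ℝ → x ⊕ y ≃ 0ℝ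
_⊞_ = ⊕-≃0

-- The first argument is the combination of hypotheses, the second the identity exhibiting `x ⊝ y`
-- as that combination; together they certify membership in the ideal of the hypotheses.
by : ∀ {x y z} → z ≃ 0ℝ → x ⊝ y ≃ z → x ≃ y
by z≃0 x⊝y≃z = difference⁻¹ (≃-trans x⊝y≃z z≃0)

-- Signs of reals without deciding them

Pos-1 : Pos 1ℝ
Pos-1 = bounded-below⇒pos {ε = 1ℚ} (ℚ.positive⁻¹ 1ℚ) (0 , λ _ _ → ℚ.≤-refl)

¬Pos-0 : ¬ Pos 0ℝ
¬Pos-0 0>0 = let ε , ε>0 , N , 0≥ε = pos⇒bounded-below 0>0 in
  ℚ.<-irrefl refl (ℚ.<-≤-trans ε>0 (0≥ε N ℕ.≤-refl))

pos⇒≄0 : ∀ {x} → Pos x → ¬ x ≃ 0ℝ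
pos⇒≄0 x>0 x≃0 = ¬Pos-0 (Pos-resp-≃ x≃0 x>0)

pos⇒¬neg : ∀ {x} → Pos x → ¬ Pos (⊖ x)
pos⇒¬neg {x} x>0 -x>0 =
  ¬Pos-0 (Pos-resp-≃ (solve 1 (λ x → x :+ :- x := 0ₚ) ≃-refl x) (Pos-+ x>0 -x>0))

cancel-pos : ∀ {c x} → Pos c → c ⊗ x ≃ 0ℝ → x ≃ 0ℝ
cancel-pos {c} {x} c>0 cx≃0 = let y , _ , cy≃1 = inverse c>0 in
  by (y · cx≃0 ⊞ ⊖ x · cy≃1) (solve 3 (λ c x y →
    x :- 0ₚ := y :* (c :* x :- 0ₚ) :+ (:- x) :* (c :* y :- 1ₚ)) ≃-refl c x y)

-- The sign of `c` is unknown, so `c` cannot be inverted. Instead, a sign of `x` would let `x` be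
-- cancelled and force `c` to vanish; having no sign, `x` is 0 by `antisym`.
cancel : ∀ {c x} → ¬ c ≃ 0ℝ → c ⊗ x ≃ 0ℝ → x ≃ 0ℝ
cancel {c} {x} c≄0 cx≃0 = antisym
  (λ x>0  → c≄0 (cancel-pos x>0 (≃-trans (⊗-comm x c) cx≃0)))
  (λ -x>0 → c≄0 (cancel-pos -x>0 (by (⊖ 1ℝ · cx≃0)
    (solve 2 (λ c x → :- x :* c :- 0ₚ := :- 1ₚ :* (c :* x :- 0ₚ)) ≃-refl c x))))

-- Trichotomy, available without excluded middle because the goal is a contradiction.
sign-cases : ∀ x → (Pos x → ⊥) → (x ≃ 0ℝ → ⊥) → (Pos (⊖ x) → ⊥) → ⊥
sign-cases x x≯0 x≄0 x≮0 = x≄0 (antisym x≯0 x≮0)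

Pos⇒NonNeg : ∀ {x} → Pos x → NonNeg x
Pos⇒NonNeg x>0 = nonNeg (pos⇒¬neg x>0)

NonNeg-resp-≃ : ∀ {x y} → x ≃ y → NonNeg x → NonNeg y
NonNeg-resp-≃ x≃y x≥0 = nonNeg λ -y>0 → nonNeg⁻¹ x≥0 (Pos-resp-≃ (⊖-cong (≃-sym x≃y)) -y>0)

nonNeg-cases : ∀ x → (NonNeg x → ⊥) → (NonNeg (⊖ x) → ⊥) → ⊥
nonNeg-cases x f g = f (nonNeg λ -x>0 → g (Pos⇒NonNeg -x>0))

NonNeg-+ : ∀ {x y} → NonNeg x → NonNeg y → NonNeg (x ⊕ y)
NonNeg-+ {x} {y} x≥0 y≥0 = nonNeg λ -[x+y]>0 → sign-cases x
  (λ x>0 → nonNeg⁻¹ y≥0 (Pos-resp-≃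
     (solve 2 (λ x y → :- (x :+ y) :+ x := :- y) ≃-refl x y) (Pos-+ -[x+y]>0 x>0)))
  (λ x≃0 → nonNeg⁻¹ y≥0 (Pos-resp-≃ (by (⊖ 1ℝ · x≃0)
     (solve 2 (λ x y → :- (x :+ y) :- :- y := :- 1ₚ :* (x :- 0ₚ)) ≃-refl x y)) -[x+y]>0))
  (nonNeg⁻¹ x≥0)

NonNeg-* : ∀ {x y} → NonNeg x → NonNeg y → NonNeg (x ⊗ y)
NonNeg-* {x} {y} x≥0 y≥0 = nonNeg λ -xy>0 → sign-cases x
  (λ x>0 → sign-cases y
    (λ y>0 → pos⇒¬neg (Pos-* x>0 y>0) -xy>0)
    (λ y≃0 → pos⇒≄0 -xy>0 (by (⊖ x · y≃0)
      (solve 2 (λ x y → :- (x :* y) :- 0ₚ := :- x :* (y :- 0ₚ)) ≃-refl x y)))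
    (nonNeg⁻¹ y≥0))
  (λ x≃0 → pos⇒≄0 -xy>0 (by (⊖ y · x≃0)
    (solve 2 (λ x y → :- (x :* y) :- 0ₚ := :- y :* (x :- 0ₚ)) ≃-refl x y)))
  (nonNeg⁻¹ x≥0)

≤⇒NonNeg : ∀ {x y} → x ≤ y → NonNeg (y ⊝ x)
≤⇒NonNeg {x} {y} x≤y = nonNeg λ p → x≤y (Pos⇒< (Pos-resp-≃
  (solve 2 (λ x y → :- (y :- x) := x :- y) ≃-refl x y) p))

NonNeg⇒≤ : ∀ {x y} → NonNeg (y ⊝ x) → x ≤ y
NonNeg⇒≤ {x} {y} x≤y y<x = nonNeg⁻¹ x≤y (Pos-resp-≃
  (solve 2 (λ x y → x :- y := :- (y :- x)) ≃-refl x y) (<⇒Pos y<x))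

-- Points, segments and their lines

infix 4 _≃ₚ_

record _≃ₚ_ (P R : Point) : Set where
  constructor wrap
  field
    x≃ : xc P ≃ xc R
    y≃ : yc P ≃ yc R

open _≃ₚ_ public

wrapₚ : ∀ {P R} → P ≈ₚ R → P ≃ₚ R
wrapₚ (x≈ , y≈) = wrap (wrap x≈) (wrap y≈)

unwrapₚ : ∀ {P R} → P ≃ₚ R → P ≈ₚ R
unwrapₚ (wrap (wrap x≈) (wrap y≈)) = x≈ , y≈

≃ₚ-sym : ∀ {P R} → P ≃ₚ R → R ≃ₚ P
≃ₚ-sym (wrap x y) = wrap (≃-sym x) (≃-sym y)

≃ₚ-trans : ∀ {P R T} → P ≃ₚ R → R ≃ₚ T → P ≃ₚ T
≃ₚ-trans (wrap x y) (wrap x′ y′) = wrap (≃-trans x x′) (≃-trans y y′)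

affine : Point → Point → ℝ → Point
affine P R t = pt (xc P ⊕ t ⊗ (xc R ⊝ xc P)) (yc P ⊕ t ⊗ (yc R ⊝ yc P))

opaque
  unfolding _⊕_

  along-affine : ∀ {P R t} → along P R t ≃ₚ affine P R t
  along-affine = wrap (pointwise λ _ → refl) (pointwise λ _ → refl)

at : Segment → ℝ → Point
at s = affine (start s) (end s)

parameter : ∀ {P} s → P ∈ s → ∃[ t ] NonNeg t × NonNeg (1ℝ ⊝ t) × P ≃ₚ at s t
parameter s (t , 0≤t , t≤1 , eq) = t , wrap 0≤t , ≤⇒NonNeg t≤1 , ≃ₚ-trans (wrapₚ eq) along-affine

parameter⁻¹ : ∀ {P} s t → NonNeg t → NonNeg (1ℝ ⊝ t) → P ≃ₚ at s t → P ∈ s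
parameter⁻¹ s t t≥0 t≤1 eq =
  t , unwrap t≥0 , NonNeg⇒≤ t≤1 , unwrapₚ (≃ₚ-trans eq (≃ₚ-sym along-affine))

∈-resp-≃ₚ : ∀ {P R} s → P ≃ₚ R → P ∈ s → R ∈ s
∈-resp-≃ₚ s P≃R P∈s = let t , t≥0 , t≤1 , eq = parameter s P∈s in
  parameter⁻¹ s t t≥0 t≤1 (≃ₚ-trans (≃ₚ-sym P≃R) eq)

segment-convex : ∀ {P R Q} s l → NonNeg l → NonNeg (1ℝ ⊝ l) → P ∈ s → R ∈ s →
  Q ≃ₚ affine P R l → Q ∈ s
segment-convex s l l≥0 l≤1 P∈s R∈s (wrap qx qy) =
  let a , a≥0 , a≤1 , wrap px py = parameter s P∈s
      b , b≥0 , b≤1 , wrap rx ry = parameter s R∈s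
  in parameter⁻¹ s ((1ℝ ⊝ l) ⊗ a ⊕ l ⊗ b)
    (NonNeg-+ (NonNeg-* l≤1 a≥0) (NonNeg-* l≥0 b≥0))
    (NonNeg-resp-≃ (solve 3 (λ a b l →
        (1ₚ :- l) :* (1ₚ :- a) :+ l :* (1ₚ :- b) := 1ₚ :- ((1ₚ :- l) :* a :+ l :* b))
        ≃-refl a b l)
      (NonNeg-+ (NonNeg-* l≤1 a≤1) (NonNeg-* l≥0 b≤1)))
    (wrap (nested px rx qx) (nested py ry qy))
  where
  nested : ∀ {p r u v a b l q} → p ≃ u ⊕ a ⊗ (v ⊝ u) → r ≃ u ⊕ b ⊗ (v ⊝ u) →
    q ≃ p ⊕ l ⊗ (r ⊝ p) → q ≃ u ⊕ ((1ℝ ⊝ l) ⊗ a ⊕ l ⊗ b) ⊗ (v ⊝ u)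
  nested {p} {r} {u} {v} {a} {b} {l} {q} p≃ r≃ q≃ =
    by (1ℝ · q≃ ⊞ (1ℝ ⊝ l) · p≃ ⊞ l · r≃) (solve 8 (λ p r u v a b l q →
      q :- (u :+ ((1ₚ :- l) :* a :+ l :* b) :* (v :- u))
      := 1ₚ :* (q :- (p :+ l :* (r :- p)))
         :+ ((1ₚ :- l) :* (p :- (u :+ a :* (v :- u)))
         :+ l :* (r :- (u :+ b :* (v :- u)))))
      ≃-refl p r u v a b l q)

-- Q divides P R at the parameter (y - x)/(z - x), so this is convexity of `u`. The strict
-- inequality between `x` and `z` supplies the reciprocal.
between∈ : ∀ {P Q R x y z} s u → P ≃ₚ at s x → Q ≃ₚ at s y → R ≃ₚ at s z →
  NonNeg (y ⊝ x) → NonNeg (z ⊝ y) → Pos (z ⊝ x) → P ∈ u → R ∈ u → Q ∈ u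
between∈ {x = x} {y} {z} s u (wrap px py) (wrap qx qy) (wrap rx ry) x≤y y≤z x<z P∈u R∈u =
  let w , w>0 , inv = inverse x<z in
  segment-convex u ((y ⊝ x) ⊗ w) (NonNeg-* x≤y (Pos⇒NonNeg w>0))
    (NonNeg-resp-≃ (by (1ℝ · inv) (solve 4 (λ x y z w →
       (z :- y) :* w :- (1ₚ :- (y :- x) :* w) := 1ₚ :* ((z :- x) :* w :- 1ₚ))
       ≃-refl x y z w))
      (NonNeg-* y≤z (Pos⇒NonNeg w>0)))
    P∈u R∈u
    (wrap (interpolate inv px rx qx) (interpolate inv py ry qy))
  where
  interpolate : ∀ {p r q u v x y z w} → (z ⊝ x) ⊗ w ≃ 1ℝ →
    p ≃ u ⊕ x ⊗ (v ⊝ u) → r ≃ u ⊕ z ⊗ (v ⊝ u) → q ≃ u ⊕ y ⊗ (v ⊝ u) →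
    q ≃ p ⊕ (y ⊝ x) ⊗ w ⊗ (r ⊝ p)
  interpolate {p} {r} {q} {u} {v} {x} {y} {z} {w} inv p≃ r≃ q≃ =
    by (1ℝ · q≃ ⊞ ((y ⊝ x) ⊗ w ⊝ 1ℝ) · p≃ ⊞ ⊖ ((y ⊝ x) ⊗ w) · r≃ ⊞ ⊖ ((y ⊝ x) ⊗ (v ⊝ u)) · inv)
    (solve 9 (λ p r q u v x y z w →
      q :- (p :+ (y :- x) :* w :* (r :- p))
      := 1ₚ :* (q :- (u :+ y :* (v :- u)))
         :+ (((y :- x) :* w :- 1ₚ) :* (p :- (u :+ x :* (v :- u)))
         :+ ((:- ((y :- x) :* w)) :* (r :- (u :+ z :* (v :- u)))
         :+ (:- ((y :- x) :* (v :- u))) :* ((z :- x) :* w :- 1ₚ))))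
      ≃-refl p r q u v x y z w)

-- The cross product of the direction of s with P - start s, an affine
-- function of P whose zeros are the points of the line through s.
side : Segment → Point → ℝ
side s P = (xc (end s) ⊝ xc (start s)) ⊗ (yc P ⊝ yc (start s))
         ⊝ (yc (end s) ⊝ yc (start s)) ⊗ (xc P ⊝ xc (start s))

side-at : ∀ s {P t} → P ≃ₚ at s t → side s P ≃ 0ℝ
side-at s {P} {t} (wrap px py) =
  by ((xc (end s) ⊝ xc (start s)) · py ⊞ ⊖ (yc (end s) ⊝ yc (start s)) · px)
    (solve 7 (λ p q u v x y t →
      (x :- u) :* (q :- v) :- (y :- v) :* (p :- u) :- 0ₚ
      := (x :- u) :* (q :- (v :+ t :* (y :- v))) :+ (:- (y :- v)) :* (p :- (u :+ t :* (x :- u))))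
      ≃-refl (xc P) (yc P) (xc (start s)) (yc (start s)) (xc (end s)) (yc (end s)) t)

inverse¬¬ : ∀ {x} → ¬ x ≃ 0ℝ → ¬ ¬ (∃[ y ] x ⊗ y ≃ 1ℝ)
inverse¬¬ {x} x≄0 none = sign-cases x
  (λ x>0 → let y , _ , xy≃1 = inverse x>0 in none (y , xy≃1))
  x≄0
  (λ -x>0 → let y , _ , -xy≃1 = inverse -x>0 in none (⊖ y , ≃-trans
    (solve 2 (λ x y → x :* :- y := :- x :* y) ≃-refl x y) -xy≃1))

-- Some coordinate of the direction of `s` is nonzero, and dividing by it gives the parameter. Which
-- coordinate it is cannot be decided, hence the double negation; it is harmless where a
-- contradiction is the goal.
side≃0⇒at : ∀ s {P} → side s P ≃ 0ℝ → ¬ ¬ (∃[ t ] P ≃ₚ at s t)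
side≃0⇒at s {P} side≃0 none =
  inverse¬¬ (λ dx≃0 → inverse¬¬ (λ dy≃0 → distinct s (unwrapₚ
      (wrap (≃-sym (difference⁻¹ dx≃0)) (≃-sym (difference⁻¹ dy≃0)))))
    λ { (w , inv) → let y≃ , x≃ = parallel inv (≃-sym (difference⁻¹ side≃0)) in none (_ , wrap x≃ y≃) })
  λ { (w , inv) → let x≃ , y≃ = parallel inv (difference⁻¹ side≃0) in none (_ , wrap x≃ y≃) }
  where
  parallel : ∀ {x y u v p q w} → (x ⊝ u) ⊗ w ≃ 1ℝ →
    (x ⊝ u) ⊗ (q ⊝ v) ≃ (y ⊝ v) ⊗ (p ⊝ u) →
    p ≃ u ⊕ (p ⊝ u) ⊗ w ⊗ (x ⊝ u) × q ≃ v ⊕ (p ⊝ u) ⊗ w ⊗ (y ⊝ v)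
  parallel {x} {y} {u} {v} {p} {q} {w} inv par =
    by (⊖ (p ⊝ u) · inv) (solve 4 (λ x u p w →
      p :- (u :+ (p :- u) :* w :* (x :- u)) := (:- (p :- u)) :* ((x :- u) :* w :- 1ₚ))
      ≃-refl x u p w)
    , by (⊖ (q ⊝ v) · inv ⊞ w · par) (solve 7 (λ x y u v p q w →
      q :- (v :+ (p :- u) :* w :* (y :- v))
      := (:- (q :- v)) :* ((x :- u) :* w :- 1ₚ) :+ w :* ((x :- u) :* (q :- v) :- (y :- v) :* (p :- u)))
      ≃-refl x y u v p q w)

module _ {S : Fin 4 → Segment} (conf : IsConfiguration S) where
  open IsConfiguration conf

  -- Helly's theorem on the line of S k: if P were on it, one of the three
  -- pairwise intersection points would lie between the other two, hence on all
  -- three segments.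
  intersection-off-third : ∀ {i j k P} → i ≢ j → j ≢ k → i ≢ k →
    P ∈ S i → P ∈ S j → ¬ side (S k) P ≃ 0ℝ
  intersection-off-third {i} {j} {k} {P} i≢j j≢k i≢k P∈i P∈j P∈ℓ =
    let Q , Q∈j , Q∈k = pairwise-meet j k j≢k
        R , R∈i , R∈k = pairwise-meet i k i≢k
        q , q≥0 , q≤1 , Qq = parameter {Q} (S k) Q∈k
        r , r≥0 , r≤1 , Rr = parameter {R} (S k) R∈k
        Q∉i = λ Q∈i → no-three-meet i j k i≢j j≢k i≢k Q (Q∈i , Q∈j , Q∈k)
        R∉j = λ R∈j → no-three-meet i j k i≢j j≢k i≢k R (R∈i , R∈j , R∈k)
    in side≃0⇒at (S k) P∈ℓ λ { (t , Pt) →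
      no-three-meet i j k i≢j j≢k i≢k P (P∈i , P∈j , parameter⁻¹ (S k) t
        -- If t < 0, P precedes both Q and R. The nearer of the two then lies between P and the
        -- other, both of which lie on a segment that does not contain the nearer one. The case t >
        -- 1 is the mirror image.
        (nonNeg λ t<0 → nonNeg-cases (r ⊝ q)
          (λ q≤r → Q∉i (between∈ {P} {Q} {R} (S k) (S i) Pt Qq Rr
            (Pos⇒NonNeg (after t<0 q≥0)) q≤r (after t<0 r≥0) P∈i R∈i))
          (λ r≤q → R∉j (between∈ {P} {R} {Q} (S k) (S j) Pt Rr Qq
            (Pos⇒NonNeg (after t<0 r≥0)) (flip r≤q) (after t<0 q≥0) P∈j Q∈j)))
        (nonNeg λ t>1 → nonNeg-cases (r ⊝ q)
          (λ q≤r → R∉j (between∈ {Q} {R} {P} (S k) (S j) Qq Rr Pt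
            q≤r (Pos⇒NonNeg (before t>1 r≤1)) (before t>1 q≤1) Q∈j P∈j))
          (λ r≤q → Q∉i (between∈ {R} {Q} {P} (S k) (S i) Rr Qq Pt
            (flip r≤q) (Pos⇒NonNeg (before t>1 q≤1)) (before t>1 r≤1) R∈i P∈i)))
        Pt) }
    where
    flip : ∀ {x y} → NonNeg (⊖ (x ⊝ y)) → NonNeg (y ⊝ x)
    flip {x} {y} = NonNeg-resp-≃ (solve 2 (λ x y → :- (x :- y) := y :- x) ≃-refl x y)
    after : ∀ {t q} → Pos (⊖ t) → NonNeg q → Pos (q ⊝ t)
    after {t} {q} t<0 q≥0 = Pos-resp-≃ (⊕-comm (⊖ t) q) (Pos+NonNeg t<0 q≥0)
    before : ∀ {t q} → Pos (⊖ (1ℝ ⊝ t)) → NonNeg (1ℝ ⊝ q) → Pos (t ⊝ q)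
    before {t} {q} t>1 q≤1 = Pos-resp-≃
      (solve 2 (λ t q → :- (1ₚ :- t) :+ (1ₚ :- q) := t :- q) ≃-refl t q) (Pos+NonNeg t>1 q≤1)

permuted : ∀ {S} → IsConfiguration S → (π : Permutation′ 4) → IsConfiguration (λ i → S (π ⟨$⟩ʳ i))
permuted conf π = record
  { pairwise-meet = λ i j i≢j → pairwise-meet _ _ (i≢j ∘ injective)
  ; no-three-meet = λ i j k i≢j j≢k i≢k →
      no-three-meet _ _ _ (i≢j ∘ injective) (j≢k ∘ injective) (i≢k ∘ injective)
  }
  where
  open IsConfiguration conf
  open Injection (↔⇒↣ π) using (injective)

side-resp-≃ₚ : ∀ s {P R} → P ≃ₚ R → side s P ≃ side s R
side-resp-≃ₚ s (wrap x≃ y≃) =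
  ⊕-cong (⊗-cong ≃-refl (⊕-cong y≃ ≃-refl)) (⊖-cong (⊗-cong ≃-refl (⊕-cong x≃ ≃-refl)))

side-affine : ∀ s P R t → side s (affine P R t) ≃ (1ℝ ⊝ t) ⊗ side s P ⊕ t ⊗ side s R
side-affine s P R t = solve 9 (λ u v x y px py rx ry t →
  (x :- u) :* (py :+ t :* (ry :- py) :- v) :- (y :- v) :* (px :+ t :* (rx :- px) :- u)
  := (1ₚ :- t) :* ((x :- u) :* (py :- v) :- (y :- v) :* (px :- u))
     :+ t :* ((x :- u) :* (ry :- v) :- (y :- v) :* (rx :- u)))
  ≃-refl (xc (start s)) (yc (start s)) (xc (end s)) (yc (end s)) (xc P) (yc P) (xc R) (yc R) t

∈⇒side≃0 : ∀ s P → P ∈ s → side s P ≃ 0ℝ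
∈⇒side≃0 s P P∈s = let _ , _ , _ , P≃ = parameter {P} s P∈s in side-at s P≃

-- Lengths and the two relations

dist² : Point → Point → ℝ
dist² P R = (xc R ⊝ xc P) ⊗ (xc R ⊝ xc P) ⊕ (yc R ⊝ yc P) ⊗ (yc R ⊝ yc P)

dist²-sym : ∀ P R → dist² P R ≃ dist² R P
dist²-sym P R = solve 4 (λ px py rx ry →
  (rx :- px) :* (rx :- px) :+ (ry :- py) :* (ry :- py)
  := (px :- rx) :* (px :- rx) :+ (py :- ry) :* (py :- ry)) ≃-refl (xc P) (yc P) (xc R) (yc R)

opaque
  unfolding _⊕_

  length² : ∀ ℓ P R → IsLength ℓ (P , R) → ℓ ⊗ ℓ ≃ dist² P R
  length² ℓ P R (_ , ℓ²≈) = wrap ℓ²≈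

  product-length² : ∀ b a P R → IsLength (b * a) (P , R) → b ⊗ a ⊗ (b ⊗ a) ≃ dist² P R
  product-length² b a P R (_ , ℓ²≈) = wrap ℓ²≈

record Betweenness (P R T : Point) : Set where
  constructor betweenness
  field
    t    : ℝ
    t>0  : Pos t
    t<1  : Pos (1ℝ ⊝ t)
    R≃   : R ≃ₚ affine P T t

betweenness⁻ : ∀ P R T → StrictlyBetween P R T → Betweenness P R T
betweenness⁻ P R T (_ , t , 0<t , t<1 , R≈) =
  betweenness t (wrap 0<t) (<⇒Pos t<1) (≃ₚ-trans (wrapₚ R≈) along-affine)

dist²-affine : ∀ {P R T t} → R ≃ₚ affine P T t →
  dist² P R ≃ t ⊗ t ⊗ dist² P T × dist² R T ≃ (1ℝ ⊝ t) ⊗ (1ℝ ⊝ t) ⊗ dist² P T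
dist²-affine {P} {R} {T} {t} (wrap x≃ y≃) =
  let x₁ , x₂ = squares x≃ ; y₁ , y₂ = squares y≃ in
  ≃-trans (⊕-cong x₁ y₁) (≃-sym (⊗-distribˡ-⊕ _ _ _)) ,
  ≃-trans (⊕-cong x₂ y₂) (≃-sym (⊗-distribˡ-⊕ _ _ _))
  where
  squares : ∀ {p r q} → r ≃ p ⊕ t ⊗ (q ⊝ p) →
    (r ⊝ p) ⊗ (r ⊝ p) ≃ t ⊗ t ⊗ ((q ⊝ p) ⊗ (q ⊝ p)) ×
    (q ⊝ r) ⊗ (q ⊝ r) ≃ (1ℝ ⊝ t) ⊗ (1ℝ ⊝ t) ⊗ ((q ⊝ p) ⊗ (q ⊝ p))
  squares {p} {r} {q} e =
    by ((r ⊝ p ⊕ t ⊗ (q ⊝ p)) · e) (solve 4 (λ p r q t →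
      (r :- p) :* (r :- p) :- t :* t :* ((q :- p) :* (q :- p))
      := (r :- p :+ t :* (q :- p)) :* (r :- (p :+ t :* (q :- p)))) ≃-refl p r q t) ,
    by (⊖ (q ⊝ r ⊕ (1ℝ ⊝ t) ⊗ (q ⊝ p)) · e) (solve 4 (λ p r q t →
      (q :- r) :* (q :- r) :- (1ₚ :- t) :* (1ₚ :- t) :* ((q :- p) :* (q :- p))
      := (:- (q :- r :+ (1ₚ :- t) :* (q :- p))) :* (r :- (p :+ t :* (q :- p)))) ≃-refl p r q t)

-- Lengths are known only through their squares, which give t²(ba)² = (1 - t)²a². The difference of
-- the two sides is a²(bt + (1 - t))(bt - (1 - t)), whose first two factors are positive.
ratio : ∀ {P R T t a b} → R ≃ₚ affine P T t → Pos t → Pos (1ℝ ⊝ t) → Pos a → Pos b →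
  a ⊗ a ≃ dist² P R → b ⊗ a ⊗ (b ⊗ a) ≃ dist² R T → b ⊗ t ≃ 1ℝ ⊝ t
ratio {P} {R} {T} {t} {a} {b} R≃ t>0 t<1 a>0 b>0 a² b² =
  let PR² , RT² = dist²-affine R≃ in
  difference⁻¹ (cancel-pos (Pos-* (Pos-* a>0 a>0) (Pos-+ (Pos-* b>0 t>0) t<1))
    (by (⊖ ((1ℝ ⊝ t) ⊗ (1ℝ ⊝ t)) · ≃-trans a² PR² ⊞ t ⊗ t · ≃-trans b² RT²)
      (solve 4 (λ t a b u →
        a :* a :* (b :* t :+ (1ₚ :- t)) :* (b :* t :- (1ₚ :- t)) :- 0ₚ
        := (:- ((1ₚ :- t) :* (1ₚ :- t))) :* (a :* a :- t :* t :* u)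
           :+ t :* t :* (b :* a :* (b :* a) :- (1ₚ :- t) :* (1ₚ :- t) :* u))
        ≃-refl t a b (dist² P T))))

record Relations (b₁ b₂ b₃ b₄ : ℝ) : Set where
  constructor relations
  field
    b₁>0  : Pos b₁
    b₂>0  : Pos b₂
    b₃>0  : Pos b₃
    b₄>0  : Pos b₄
    b₂b₃≃ : b₂ ⊗ b₃ ≃ b₁ ⊗ (b₂ ⊕ 1ℝ)
    b₁b₄≃ : b₁ ⊗ b₄ ≃ b₂ ⊗ (b₁ ⊕ 1ℝ)

-- Since bᵢtᵢ = 1 - tᵢ and (b₂ + 1)t₂ = 1, multiplying by t₁t₂t₃ turns the claim into t₁(1 - t₂)(1 -
-- t₃) = (1 - t₁)t₃. This rearranges to t₁(1 - (1 - t₃)t₂) = t₃, which is the two crossing equations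
-- combined.
ratio-product : ∀ {b₁ b₂ b₃ t₁ t₂ t₃ t₄} → Pos t₁ → Pos t₂ → Pos t₃ →
  b₁ ⊗ t₁ ≃ 1ℝ ⊝ t₁ → b₂ ⊗ t₂ ≃ 1ℝ ⊝ t₂ → b₃ ⊗ t₃ ≃ 1ℝ ⊝ t₃ →
  t₃ ≃ (1ℝ ⊝ t₄) ⊗ t₁ → t₄ ≃ (1ℝ ⊝ t₃) ⊗ t₂ →
  b₂ ⊗ b₃ ≃ b₁ ⊗ (b₂ ⊕ 1ℝ)
ratio-product {b₁} {b₂} {b₃} {t₁} {t₂} {t₃} {t₄} t₁>0 t₂>0 t₃>0 h₁ h₂ h₃ g₃ g₄ =
  difference⁻¹ (cancel-pos (Pos-* (Pos-* t₁>0 t₂>0) t₃>0)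
    (by (t₁ ⊗ (b₃ ⊗ t₃) ⊝ (1ℝ ⊝ t₁) ⊗ t₃ · h₂ ⊞ t₁ ⊗ (1ℝ ⊝ t₂) · h₃
         ⊞ ⊖ (t₃ ⊗ (b₂ ⊗ t₂ ⊕ t₂)) · h₁ ⊞ ⊖ 1ℝ · g₃ ⊞ t₁ · g₄)
      (solve 7 (λ b₁ b₂ b₃ t₁ t₂ t₃ t₄ →
        t₁ :* t₂ :* t₃ :* (b₂ :* b₃ :- b₁ :* (b₂ :+ 1ₚ)) :- 0ₚ
        := (t₁ :* (b₃ :* t₃) :- (1ₚ :- t₁) :* t₃) :* (b₂ :* t₂ :- (1ₚ :- t₂))
           :+ (t₁ :* (1ₚ :- t₂) :* (b₃ :* t₃ :- (1ₚ :- t₃))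
           :+ ((:- (t₃ :* (b₂ :* t₂ :+ t₂))) :* (b₁ :* t₁ :- (1ₚ :- t₁))
           :+ ((:- 1ₚ) :* (t₃ :- (1ₚ :- t₄) :* t₁)
           :+ t₁ :* (t₄ :- (1ₚ :- t₃) :* t₂)))))
        ≃-refl b₁ b₂ b₃ t₁ t₂ t₃ t₄)))

-- Evaluate side s, which vanishes at P, Q and P′, at T along both of its lines.
crossing-parameter : ∀ s {P Q T P′ R X t u w} → side s P ≃ 0ℝ → side s Q ≃ 0ℝ → side s P′ ≃ 0ℝ →
  ¬ side s X ≃ 0ℝ → R ≃ₚ affine P X t → T ≃ₚ affine R Q u → T ≃ₚ affine P′ X w →
  w ≃ (1ℝ ⊝ u) ⊗ t
crossing-parameter s {P} {Q} {T} {P′} {R} {X} {t} {u} {w} fP fQ fP′ fX R≃ T≃ T≃′ =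
  difference⁻¹ (cancel fX (by
    (⊖ 1ℝ · value T≃′ ⊞ 1ℝ · value T≃ ⊞ (1ℝ ⊝ u) · value R≃ ⊞ (1ℝ ⊝ u) ⊗ (1ℝ ⊝ t) · fP
      ⊞ u · fQ ⊞ ⊖ (1ℝ ⊝ w) · fP′)
    (solve 9 (λ fT fP fQ fP′ fR fX t u w →
      fX :* (w :- (1ₚ :- u) :* t) :- 0ₚ
      := (:- 1ₚ) :* (fT :- ((1ₚ :- w) :* fP′ :+ w :* fX))
         :+ (1ₚ :* (fT :- ((1ₚ :- u) :* fR :+ u :* fQ))
         :+ ((1ₚ :- u) :* (fR :- ((1ₚ :- t) :* fP :+ t :* fX))
         :+ ((1ₚ :- u) :* (1ₚ :- t) :* (fP :- 0ₚ)
         :+ (u :* (fQ :- 0ₚ)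
         :+ (:- (1ₚ :- w)) :* (fP′ :- 0ₚ))))))
      ≃-refl (side s T) (side s P) (side s Q) (side s P′) (side s R) (side s X) t u w)))
  where
  value : ∀ {A B C l} → C ≃ₚ affine A B l → side s C ≃ (1ℝ ⊝ l) ⊗ side s A ⊕ l ⊗ side s B
  value C≃ = ≃-trans (side-resp-≃ₚ s C≃) (side-affine s _ _ _)

hasRatios⇒relations : ∀ {S} → IsConfiguration S → (b : Fin 4 → ℝ) → HasRatios S b →
  Relations (b 0F) (b 1F) (b 2F) (b 3F)
hasRatios⇒relations {S} conf b has = relations
  (wrap (b>0 0F)) (wrap (b>0 1F)) (wrap (b>0 2F)) (wrap (b>0 3F))
  (ratio-product ℓ₁.t>0 ℓ₂.t>0 ℓ₃.t>0 h₁ h₂ h₃ g₃ g₄)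
  -- Exchanging the indices 1 with 2 and 3 with 4 swaps X with Y and preserves the labelling
  -- convention; it turns the first relation into the second.
  (ratio-product ℓ₂.t>0 ℓ₁.t>0 ℓ₄.t>0 h₂ h₁ h₄ g₄ g₃)
  where
  open HasRatios has
  open Labelling labelling
  conf′ = permuted conf order
  module ℓ₁ = Betweenness (betweenness⁻ P₁₂ P₄₁ X on-ℓ₁)
  module ℓ₂ = Betweenness (betweenness⁻ P₁₂ P₂₃ Y on-ℓ₂)
  module ℓ₃ = Betweenness (betweenness⁻ P₂₃ P₃₄ X on-ℓ₃)
  module ℓ₄ = Betweenness (betweenness⁻ P₄₁ P₃₄ Y on-ℓ₄)
  a′>0 : ∀ i → Pos (a i)
  a′>0 i = wrap (a>0 i)
  b′>0 : ∀ i → Pos (b i)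
  b′>0 i = wrap (b>0 i)
  h₁ = ratio ℓ₁.R≃ ℓ₁.t>0 ℓ₁.t<1 (a′>0 0F) (b′>0 0F)
         (≃-trans (length² (a 0F) P₄₁ P₁₂ (length-A 0F)) (dist²-sym P₄₁ P₁₂))
         (product-length² (b 0F) (a 0F) P₄₁ X (length-B 0F))
  h₂ = ratio ℓ₂.R≃ ℓ₂.t>0 ℓ₂.t<1 (a′>0 1F) (b′>0 1F)
         (length² (a 1F) P₁₂ P₂₃ (length-A 1F)) (product-length² (b 1F) (a 1F) P₂₃ Y (length-B 1F))
  h₃ = ratio ℓ₃.R≃ ℓ₃.t>0 ℓ₃.t<1 (a′>0 2F) (b′>0 2F)
         (length² (a 2F) P₂₃ P₃₄ (length-A 2F)) (product-length² (b 2F) (a 2F) P₃₄ X (length-B 2F))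
  h₄ = ratio ℓ₄.R≃ ℓ₄.t>0 ℓ₄.t<1 (a′>0 3F) (b′>0 3F)
         (≃-trans (length² (a 3F) P₃₄ P₄₁ (length-A 3F)) (dist²-sym P₃₄ P₄₁))
         (product-length² (b 3F) (a 3F) P₃₄ Y (length-B 3F))
  -- The equation of ℓ₂ vanishes at P₁₂, Y and P₂₃. Its value at P₃₄ is (1 - t₄)t₁ times its value
  -- at X when reached through P₄₁ on ℓ₄, and t₃ times that value on ℓ₃.
  g₃ = crossing-parameter (s 1F)
    (∈⇒side≃0 (s 1F) P₁₂ (proj₂ P₁₂∈)) (∈⇒side≃0 (s 1F) Y (proj₁ Y∈)) (∈⇒side≃0 (s 1F) P₂₃ (proj₁ P₂₃∈))
    (intersection-off-third conf′ {0F} {2F} {1F} {X} (λ ()) (λ ()) (λ ()) (proj₁ X∈) (proj₂ X∈))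
    ℓ₁.R≃ ℓ₄.R≃ ℓ₃.R≃
  g₄ = crossing-parameter (s 0F)
    (∈⇒side≃0 (s 0F) P₁₂ (proj₁ P₁₂∈)) (∈⇒side≃0 (s 0F) X (proj₁ X∈)) (∈⇒side≃0 (s 0F) P₄₁ (proj₂ P₄₁∈))
    (intersection-off-third conf′ {1F} {3F} {0F} {Y} (λ ()) (λ ()) (λ ()) (proj₁ Y∈) (proj₂ Y∈))
    ℓ₂.R≃ ℓ₃.R≃ ℓ₄.R≃

-- Zeros of affine functions and division ratios

data Axis : Set where
  horizontal vertical : Axis

coord : Axis → Point → ℝ
coord horizontal = xc
coord vertical   = yc

coord-cong : ∀ k {P R} → P ≃ₚ R → coord k P ≃ coord k R
coord-cong horizontal = x≃
coord-cong vertical   = y≃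

coord⁻¹ : ∀ {P R} → (∀ k → coord k P ≃ coord k R) → P ≃ₚ R
coord⁻¹ eq = wrap (eq horizontal) (eq vertical)

coord-affine : ∀ k {P R T t} → R ≃ₚ affine P T t →
  coord k R ≃ coord k P ⊕ t ⊗ (coord k T ⊝ coord k P)
coord-affine horizontal = x≃
coord-affine vertical   = y≃

-- (R - P) : (T - R) = p : q
record DividesInRatio (P R T : Point) (p q : ℝ) : Set where
  constructor divides
  field equation : ∀ k → q ⊗ (coord k R ⊝ coord k P) ≃ p ⊗ (coord k T ⊝ coord k R)

open DividesInRatio

dividesInRatio⇒strictlyBetween : ∀ {P R T p q} → ¬ P ≃ₚ T → Pos p → Pos q →
  DividesInRatio P R T p q → StrictlyBetween P R T
dividesInRatio⇒strictlyBetween {P} {R} {T} {p} {q} P≄T p>0 q>0 (divides eq) =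
  let w , w>0 , inv = inverse (Pos-+ p>0 q>0) in
  (λ P≈T → P≄T (wrapₚ P≈T))
  , p ⊗ w
  , unwrap (Pos-* p>0 w>0)
  , Pos⇒< (Pos-resp-≃ (by (1ℝ · inv) (solve 3 (λ p q w →
      q :* w :- (1ₚ :- p :* w) := 1ₚ :* ((p :+ q) :* w :- 1ₚ)) ≃-refl p q w)) (Pos-* q>0 w>0))
  , unwrapₚ (≃ₚ-trans (wrap (scaled inv (eq horizontal)) (scaled inv (eq vertical))) (≃ₚ-sym along-affine))
  where
  scaled : ∀ {x y z w} → (p ⊕ q) ⊗ w ≃ 1ℝ → q ⊗ (y ⊝ x) ≃ p ⊗ (z ⊝ y) → y ≃ x ⊕ p ⊗ w ⊗ (z ⊝ x)
  scaled {x} {y} {z} {w} inv e = by (w · e ⊞ ⊖ (y ⊝ x) · inv) (solve 6 (λ p q x y z w →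
    y :- (x :+ p :* w :* (z :- x))
    := w :* (q :* (y :- x) :- p :* (z :- y)) :+ (:- (y :- x)) :* ((p :+ q) :* w :- 1ₚ))
    ≃-refl p q x y z w)

-- D divides A B in the ratio - a : b; for an affine function with values a at
-- A and b at B this says that it vanishes at the point D of the line A B.
record VanishesAt (A D B : Point) (a b : ℝ) : Set where
  constructor vanishesAt
  field equation : ∀ k → b ⊗ (coord k D ⊝ coord k A) ≃ a ⊗ (coord k D ⊝ coord k B)

VanishesAt-sym : ∀ {A D B a b} → VanishesAt A D B a b → VanishesAt B D A b a
VanishesAt-sym (vanishesAt eq) = vanishesAt λ k → ≃-sym (eq k)

VanishesAt-neg : ∀ {A D B a b} → VanishesAt A D B a b → VanishesAt A D B (⊖ a) (⊖ b)
VanishesAt-neg (vanishesAt eq) = vanishesAt λ k → by (⊖ 1ℝ · eq k)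
  (solve 5 (λ a b x y z → (:- b) :* (y :- x) :- (:- a) :* (y :- z)
    := (:- 1ₚ) :* (b :* (y :- x) :- a :* (y :- z))) ≃-refl _ _ _ _ _)

-- Along the line of `u` the function `side s` is affine with zero D, so its values at A and B are
-- the same multiple of the signed parameters from D to A and to B. Cross-multiplying avoids
-- dividing by that slope.
side-vanishesAt : ∀ s u {A D B} → A ∈ u → D ∈ u → B ∈ u → D ∈ s →
  VanishesAt A D B (side s A) (side s B)
side-vanishesAt s u {A} {D} {B} A∈u D∈u B∈u D∈s =
  let α , _ , _ , A≃ = parameter {A} u A∈u
      δ , _ , _ , D≃ = parameter {D} u D∈u
      β , _ , _ , B≃ = parameter {B} u B∈u
      value = λ {t P} (P≃ : P ≃ₚ at u t) →
        ≃-trans (side-resp-≃ₚ s P≃) (side-affine s (start u) (end u) t)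
  in vanishesAt λ k → collinear (coord-affine k A≃) (coord-affine k D≃) (coord-affine k B≃)
       (value A≃) (≃-trans (≃-sym (∈⇒side≃0 s D D∈s)) (value D≃)) (value B≃)
  where
  collinear : ∀ {x y z p q α δ β a b f g} →
    x ≃ p ⊕ α ⊗ (q ⊝ p) → y ≃ p ⊕ δ ⊗ (q ⊝ p) → z ≃ p ⊕ β ⊗ (q ⊝ p) →
    a ≃ (1ℝ ⊝ α) ⊗ f ⊕ α ⊗ g → 0ℝ ≃ (1ℝ ⊝ δ) ⊗ f ⊕ δ ⊗ g → b ≃ (1ℝ ⊝ β) ⊗ f ⊕ β ⊗ g →
    b ⊗ (y ⊝ x) ≃ a ⊗ (y ⊝ z)
  collinear {x} {y} {z} {p} {q} {α} {δ} {β} {a} {b} {f} {g} x≃ y≃ z≃ a≃ 0≃ b≃ =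
    by (⊖ b · x≃ ⊞ (b ⊝ a) · y≃ ⊞ a · z≃ ⊞ ⊖ ((q ⊝ p) ⊗ (δ ⊝ β)) · a≃
        ⊞ ⊖ ((q ⊝ p) ⊗ (β ⊝ α)) · 0≃ ⊞ (q ⊝ p) ⊗ (δ ⊝ α) · b≃)
      (solve 12 (λ x y z p q α δ β a b f g →
        b :* (y :- x) :- a :* (y :- z)
        := (:- b) :* (x :- (p :+ α :* (q :- p)))
           :+ ((b :- a) :* (y :- (p :+ δ :* (q :- p)))
           :+ (a :* (z :- (p :+ β :* (q :- p)))
           :+ ((:- ((q :- p) :* (δ :- β))) :* (a :- ((1ₚ :- α) :* f :+ α :* g))
           :+ ((:- ((q :- p) :* (β :- α))) :* (0ₚ :- ((1ₚ :- δ) :* f :+ δ :* g))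
           :+ (q :- p) :* (δ :- α) :* (b :- ((1ₚ :- β) :* f :+ β :* g)))))))
        ≃-refl x y z p q α δ β a b f g)

-- Meant for a < 0 < b, when the zero D separates A from B.
VanishesAt⇒inside : ∀ {A D B a b} → VanishesAt A D B a b → DividesInRatio A D B (⊖ a) b
VanishesAt⇒inside (vanishesAt eq) = divides λ k → by (1ℝ · eq k)
  (solve 5 (λ a b x y z → b :* (y :- x) :- (:- a) :* (z :- y)
    := 1ₚ :* (b :* (y :- x) :- a :* (y :- z))) ≃-refl _ _ _ _ _)

-- Meant for 0 < a < b, when the values 0, a, b increase from D through A to B.
VanishesAt⇒outside : ∀ {A D B a b} → VanishesAt A D B a b → DividesInRatio D A B a (b ⊝ a)
VanishesAt⇒outside (vanishesAt eq) = divides λ k → by (⊖ 1ℝ · eq k)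
  (solve 5 (λ a b x y z → (b :- a) :* (x :- y) :- a :* (z :- x)
    := (:- 1ₚ) :* (b :* (y :- x) :- a :* (y :- z))) ≃-refl _ _ _ _ _)

DividesInRatio-sym : ∀ {P R T p q} → DividesInRatio P R T p q → DividesInRatio T R P q p
DividesInRatio-sym (divides eq) = divides λ k → by (1ℝ · eq k)
  (solve 5 (λ p q x y z → p :* (y :- z) :- q :* (x :- y)
    := 1ₚ :* (q :* (y :- x) :- p :* (z :- y))) ≃-refl _ _ _ _ _)

-- The fourth segment against the triangle A B C bounded by the other three: it
-- crosses the side opposite to A, B, C in A′, B′, C′, and a, b, c are the values
-- at A, B, C of an affine function that vanishes on its line.
record Transversal (S : Fin 4 → Segment) (a b c : ℝ) : Set where
  field
    A B C A′ B′ C′ : Point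
    A∈  : A ∈ S 1F × A ∈ S 2F
    B∈  : B ∈ S 0F × B ∈ S 2F
    C∈  : C ∈ S 0F × C ∈ S 1F
    A′∈ : A′ ∈ S 0F × A′ ∈ S 3F
    B′∈ : B′ ∈ S 1F × B′ ∈ S 3F
    C′∈ : C′ ∈ S 2F × C′ ∈ S 3F
    A′-vanishes : VanishesAt B A′ C b c
    B′-vanishes : VanishesAt A B′ C a c
    C′-vanishes : VanishesAt A C′ B a b
    a≄0 : ¬ a ≃ 0ℝ
    b≄0 : ¬ b ≃ 0ℝ
    c≄0 : ¬ c ≃ 0ℝ

transversal : ∀ {S} → IsConfiguration S → ∃[ a ] ∃[ b ] ∃[ c ] Transversal S a b c
transversal {S} conf =
  let A  , A∈  = pairwise-meet 1F 2F λ ()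
      B  , B∈  = pairwise-meet 0F 2F λ ()
      C  , C∈  = pairwise-meet 0F 1F λ ()
      A′ , A′∈ = pairwise-meet 0F 3F λ ()
      B′ , B′∈ = pairwise-meet 1F 3F λ ()
      C′ , C′∈ = pairwise-meet 2F 3F λ ()
  in side (S 3F) A , side (S 3F) B , side (S 3F) C , record
    { A = A ; B = B ; C = C ; A′ = A′ ; B′ = B′ ; C′ = C′
    ; A∈ = A∈ ; B∈ = B∈ ; C∈ = C∈ ; A′∈ = A′∈ ; B′∈ = B′∈ ; C′∈ = C′∈
    ; A′-vanishes = side-vanishesAt (S 3F) (S 0F) (proj₁ B∈) (proj₁ A′∈) (proj₁ C∈) (proj₂ A′∈)
    ; B′-vanishes = side-vanishesAt (S 3F) (S 1F) (proj₁ A∈) (proj₁ B′∈) (proj₂ C∈) (proj₂ B′∈)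
    ; C′-vanishes = side-vanishesAt (S 3F) (S 2F) (proj₂ A∈) (proj₁ C′∈) (proj₂ B∈) (proj₂ C′∈)
    ; a≄0 = intersection-off-third conf {P = A} (λ ()) (λ ()) (λ ()) (proj₁ A∈) (proj₂ A∈)
    ; b≄0 = intersection-off-third conf {P = B} (λ ()) (λ ()) (λ ()) (proj₁ B∈) (proj₂ B∈)
    ; c≄0 = intersection-off-third conf {P = C} (λ ()) (λ ()) (λ ()) (proj₁ C∈) (proj₂ C∈)
    }
  where open IsConfiguration conf

-- Reverses the order of the values while fixing every point. It is available because `Transversal`
-- asks for the values of some affine function rather than of `side` itself.
negate : ∀ {S a b c} → Transversal S a b c → Transversal S (⊖ a) (⊖ b) (⊖ c)
negate τ = record
  { A∈ = A∈ ; B∈ = B∈ ; C∈ = C∈ ; A′∈ = A′∈ ; B′∈ = B′∈ ; C′∈ = C′∈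
  ; A′-vanishes = VanishesAt-neg A′-vanishes
  ; B′-vanishes = VanishesAt-neg B′-vanishes
  ; C′-vanishes = VanishesAt-neg C′-vanishes
  ; a≄0 = a≄0 ∘ ⊖≃0 ; b≄0 = b≄0 ∘ ⊖≃0 ; c≄0 = c≄0 ∘ ⊖≃0
  }
  where
  open Transversal τ
  ⊖≃0 : ∀ {x} → ⊖ x ≃ 0ℝ → x ≃ 0ℝ
  ⊖≃0 {x} e = by (⊖ 1ℝ · e) (solve 1 (λ x → x :- 0ₚ := (:- 1ₚ) :* (:- x :- 0ₚ)) ≃-refl x)

τ₁₂ τ₂₃ τ₁₃ : Permutation′ 4
τ₁₂ = transpose 0F 1F
τ₂₃ = transpose 1F 2F
τ₁₃ = transpose 0F 2F

swap₁₂ : ∀ {S a b c} → Transversal S a b c →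
  Transversal (λ i → S (τ₁₂ ⟨$⟩ʳ i)) b a c
swap₁₂ τ = record
  { A∈ = B∈ ; B∈ = A∈ ; C∈ = swap C∈ ; A′∈ = B′∈ ; B′∈ = A′∈ ; C′∈ = C′∈
  ; A′-vanishes = B′-vanishes ; B′-vanishes = A′-vanishes ; C′-vanishes = VanishesAt-sym C′-vanishes
  ; a≄0 = b≄0 ; b≄0 = a≄0 ; c≄0 = c≄0
  }
  where open Transversal τ

swap₂₃ : ∀ {S a b c} → Transversal S a b c →
  Transversal (λ i → S (τ₂₃ ⟨$⟩ʳ i)) a c b
swap₂₃ τ = record
  { A∈ = swap A∈ ; B∈ = C∈ ; C∈ = B∈ ; A′∈ = A′∈ ; B′∈ = C′∈ ; C′∈ = B′∈
  ; A′-vanishes = VanishesAt-sym A′-vanishes ; B′-vanishes = C′-vanishes ; C′-vanishes = B′-vanishes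
  ; a≄0 = a≄0 ; b≄0 = c≄0 ; c≄0 = b≄0
  }
  where open Transversal τ

swap₁₃ : ∀ {S a b c} → Transversal S a b c →
  Transversal (λ i → S (τ₁₃ ⟨$⟩ʳ i)) c b a
swap₁₃ τ = record
  { A∈ = swap C∈ ; B∈ = swap B∈ ; C∈ = swap A∈ ; A′∈ = C′∈ ; B′∈ = B′∈ ; C′∈ = A′∈
  ; A′-vanishes = VanishesAt-sym C′-vanishes ; B′-vanishes = VanishesAt-sym B′-vanishes
  ; C′-vanishes = VanishesAt-sym A′-vanishes
  ; a≄0 = c≄0 ; b≄0 = b≄0 ; c≄0 = a≄0
  }
  where open Transversal τ

relabel : ∀ {S} (π : Permutation′ 4) → Labelling (λ i → S (π ⟨$⟩ʳ i)) → Labelling S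
relabel π l = record
  { order = order ∘ₚ π
  ; P₁₂ = P₁₂ ; P₂₃ = P₂₃ ; P₃₄ = P₃₄ ; P₄₁ = P₄₁ ; X = X ; Y = Y
  ; P₁₂∈ = P₁₂∈ ; P₂₃∈ = P₂₃∈ ; P₃₄∈ = P₃₄∈ ; P₄₁∈ = P₄₁∈ ; X∈ = X∈ ; Y∈ = Y∈
  ; on-ℓ₁ = on-ℓ₁ ; on-ℓ₂ = on-ℓ₂ ; on-ℓ₃ = on-ℓ₃ ; on-ℓ₄ = on-ℓ₄
  }
  where open Labelling l

-- The weights c, -b, a cancel the vertices, leaving c(b - a)C′ - b(c - a)B′ + a(c - b)A′ = 0 with
-- coefficients of sum 0. The signs of the coefficients tell which crossing is the middle one: C′
-- for a < 0 < b < c, and B′ for 0 < a < b < c.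
fourth-line : ∀ {S a b c} (τ : Transversal S a b c) → let open Transversal τ in
  ∀ k → b ⊗ (c ⊝ a) ⊗ (coord k C′ ⊝ coord k B′) ≃ ⊖ a ⊗ (c ⊝ b) ⊗ (coord k A′ ⊝ coord k C′)
fourth-line {a = a} {b} {c} τ k =
  by (c · equation C′-vanishes k ⊞ ⊖ b · equation B′-vanishes k ⊞ a · equation A′-vanishes k)
    (solve 9 (λ a b c x y z x′ y′ z′ →
      b :* (c :- a) :* (z′ :- y′) :- (:- a) :* (c :- b) :* (x′ :- z′)
      := c :* (b :* (z′ :- x) :- a :* (z′ :- y))
         :+ ((:- b) :* (c :* (y′ :- x) :- a :* (y′ :- z))
         :+ a :* (c :* (x′ :- y) :- b :* (x′ :- z))))
      ≃-refl a b c (coord k A) (coord k B) (coord k C) (coord k A′) (coord k B′) (coord k C′))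
  where
  open Transversal τ
  open VanishesAt

-- Labellings for the two sign patterns

module _ {S : Fin 4 → Segment} (conf : IsConfiguration S) where
  open IsConfiguration conf

  intersections-distinct : ∀ {P R} i j k → i ≢ j → j ≢ k → i ≢ k →
    P ∈ S i → P ∈ S j → R ∈ S k → ¬ P ≃ₚ R
  intersections-distinct {P} {R} i j k i≢j j≢k i≢k P∈i P∈j R∈k P≃R =
    no-three-meet i j k i≢j j≢k i≢k P (P∈i , P∈j , ∈-resp-≃ₚ {R} {P} (S k) (≃ₚ-sym P≃R) R∈k)

  -- B′ and C′ lie inside their sides and cut the triangle into A B′ C′ and Q = C B C′ B′. Since b <
  -- c, the line meets C B beyond B, which gives the second bounded triangle C′ B A′.
  label-separating : ∀ {a b c} → Transversal S a b c →
    Pos (⊖ a) → Pos b → Pos (c ⊝ b) → Labelling S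
  label-separating {a} {b} {c} τ a<0 b>0 b<c = record
    { order = transpose 0F 1F
    ; P₁₂ = C ; P₂₃ = B ; P₃₄ = C′ ; P₄₁ = B′ ; X = A ; Y = A′
    ; P₁₂∈ = swap C∈ ; P₂₃∈ = B∈ ; P₃₄∈ = C′∈ ; P₄₁∈ = swap B′∈ ; X∈ = A∈ ; Y∈ = A′∈
    ; on-ℓ₁ = dividesInRatio⇒strictlyBetween
        (intersections-distinct 0F 1F 2F (λ ()) (λ ()) (λ ()) (proj₁ C∈) (proj₂ C∈) (proj₂ A∈))
        c>0 a<0 (DividesInRatio-sym (VanishesAt⇒inside B′-vanishes))
    ; on-ℓ₂ = dividesInRatio⇒strictlyBetween
        (intersections-distinct 0F 1F 3F (λ ()) (λ ()) (λ ()) (proj₁ C∈) (proj₂ C∈) (proj₂ A′∈))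
        b<c b>0 (DividesInRatio-sym (VanishesAt⇒outside A′-vanishes))
    ; on-ℓ₃ = dividesInRatio⇒strictlyBetween
        (intersections-distinct 0F 2F 1F (λ ()) (λ ()) (λ ()) (proj₁ B∈) (proj₂ B∈) (proj₁ A∈))
        b>0 a<0 (DividesInRatio-sym (VanishesAt⇒inside C′-vanishes))
    ; on-ℓ₄ = dividesInRatio⇒strictlyBetween
        (intersections-distinct 1F 3F 0F (λ ()) (λ ()) (λ ()) (proj₁ B′∈) (proj₂ B′∈) (proj₁ A′∈))
        (Pos-* a<0 b<c) (Pos-* b>0 (Pos-+ c>0 a<0)) (divides (fourth-line τ))
    }
    where
    open Transversal τ
    c>0 : Pos c
    c>0 = Pos-resp-≃ (solve 2 (λ b c → c :- b :+ b := c) ≃-refl b c) (Pos-+ b<c b>0)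

  -- All three crossings lie outside the triangle, each beyond the vertex with the smaller value.
  -- Hence A B C is itself one of the bounded triangles, Q is A′ B′ A B, and the other triangle is A
  -- B′ C′.
  label-missing : ∀ {a b c} → Transversal S a b c →
    Pos a → Pos (b ⊝ a) → Pos (c ⊝ b) → Labelling S
  label-missing {a} {b} {c} τ a>0 a<b b<c = record
    -- The left factor of `∘ₚ` acts first: ℓ₁, ℓ₂, ℓ₃, ℓ₄ are B C, the transversal, A C and A B.
    { order = transpose 1F 2F ∘ₚ transpose 2F 3F
    ; P₁₂ = A′ ; P₂₃ = B′ ; P₃₄ = A ; P₄₁ = B ; X = C ; Y = C′
    ; P₁₂∈ = A′∈ ; P₂₃∈ = swap B′∈ ; P₃₄∈ = A∈ ; P₄₁∈ = swap B∈ ; X∈ = C∈ ; Y∈ = swap C′∈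
    ; on-ℓ₁ = dividesInRatio⇒strictlyBetween
        (intersections-distinct 0F 3F 1F (λ ()) (λ ()) (λ ()) (proj₁ A′∈) (proj₂ A′∈) (proj₂ C∈))
        b>0 b<c (VanishesAt⇒outside A′-vanishes)
    ; on-ℓ₂ = dividesInRatio⇒strictlyBetween
        (intersections-distinct 0F 3F 2F (λ ()) (λ ()) (λ ()) (proj₁ A′∈) (proj₂ A′∈) (proj₁ C′∈))
        (Pos-* c>0 a<b) (Pos-* a>0 b<c) (divides λ k → by (⊖ 1ℝ · fourth-line τ k)
          (solve 6 (λ a b c x y z →
            a :* (c :- b) :* (y :- x) :- c :* (b :- a) :* (z :- y)
            := (:- 1ₚ) :* (b :* (c :- a) :* (z :- y) :- (:- a) :* (c :- b) :* (x :- z)))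
            ≃-refl a b c (coord k A′) (coord k B′) (coord k C′)))
    ; on-ℓ₃ = dividesInRatio⇒strictlyBetween
        (intersections-distinct 1F 3F 0F (λ ()) (λ ()) (λ ()) (proj₁ B′∈) (proj₂ B′∈) (proj₁ C∈))
        a>0 (Pos-resp-≃ (solve 3 (λ a b c → c :- b :+ (b :- a) := c :- a) ≃-refl a b c) (Pos-+ b<c a<b))
        (VanishesAt⇒outside B′-vanishes)
    ; on-ℓ₄ = dividesInRatio⇒strictlyBetween
        (intersections-distinct 0F 2F 3F (λ ()) (λ ()) (λ ()) (proj₁ B∈) (proj₂ B∈) (proj₂ C′∈))
        a<b a>0 (DividesInRatio-sym (VanishesAt⇒outside C′-vanishes))
    }
    where
    open Transversal τ
    b>0 : Pos b
    b>0 = Pos-resp-≃ (solve 2 (λ a b → b :- a :+ a := b) ≃-refl a b) (Pos-+ a<b a>0)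
    c>0 : Pos c
    c>0 = Pos-resp-≃ (solve 2 (λ b c → c :- b :+ b := c) ≃-refl b c) (Pos-+ b<c b>0)

  -- With equal values the line A B would be parallel to the fourth line, although C′ lies on both.
  -- Algebraically, the equation at C′ collapses to b(A - B) = 0.
  values-distinct : ∀ {a b c} → Transversal S a b c → ¬ b ⊝ a ≃ 0ℝ
  values-distinct {a} {b} {c} τ b-a≃0 =
    intersections-distinct 1F 2F 0F (λ ()) (λ ()) (λ ()) (proj₁ A∈) (proj₂ A∈) (proj₁ B∈)
      (coord⁻¹ λ k → difference⁻¹ (cancel b≄0 (by
        (⊖ 1ℝ · VanishesAt.equation C′-vanishes k ⊞ (coord k C′ ⊝ coord k B) · b-a≃0)
        (solve 5 (λ a b x y z → b :* (x :- z) :- 0ₚ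
          := (:- 1ₚ) :* (b :* (y :- x) :- a :* (y :- z)) :+ (y :- z) :* (b :- a :- 0ₚ))
          ≃-refl a b (coord k A) (coord k C′) (coord k B)))))
    where open Transversal τ

Pos-reverse : ∀ {x y} → Pos (y ⊝ x) → Pos (⊖ x ⊝ ⊖ y)
Pos-reverse {x} {y} = Pos-resp-≃ (solve 2 (λ x y → y :- x := (:- x) :- (:- y)) ≃-refl x y)

-- Reduction to the two sign patterns

module _ (em : ExcludedMiddle 0ℓ) where

  -- The only appeal to excluded middle: a sign has to be produced here, not merely its absence
  -- refuted.
  apart : ∀ {x} → ¬ x ≃ 0ℝ → Pos x ⊎ Pos (⊖ x)
  apart {x} x≄0 with em {Pos x} | em {Pos (⊖ x)}
  ... | yes x>0 | _       = inj₁ x>0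
  ... | no _    | yes x<0 = inj₂ x<0
  ... | no x≯0  | no x≮0  = contradiction (antisym x≯0 x≮0) x≄0

  compare : ∀ {x y} → ¬ y ⊝ x ≃ 0ℝ → Pos (y ⊝ x) ⊎ Pos (x ⊝ y)
  compare {x} {y} y≄x with apart y≄x
  ... | inj₁ x<y = inj₁ x<y
  ... | inj₂ y<x = inj₂ (Pos-resp-≃ (solve 2 (λ x y → :- (y :- x) := x :- y) ≃-refl x y) y<x)

  -- If b < 0, negating the function and exchanging A with C restores the order with -b > 0, so the
  -- sign of c decides between the two patterns.
  label-sorted : ∀ {S a b c} → IsConfiguration S → Transversal S a b c →
    Pos (b ⊝ a) → Pos (c ⊝ b) → Labelling S
  label-sorted {c = c} conf τ a<b b<c
    with apart (Transversal.a≄0 τ) | apart (Transversal.b≄0 τ) | apart (Transversal.c≄0 τ)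
  ... | inj₁ a>0 | _        | _        = label-missing conf τ a>0 a<b b<c
  ... | inj₂ a<0 | inj₁ b>0 | _        = label-separating conf τ a<0 b>0 b<c
  ... | inj₂ a<0 | inj₂ b<0 | inj₁ c>0 = relabel τ₁₃
    (label-separating (permuted conf τ₁₃) (swap₁₃ (negate τ))
      (Pos-resp-≃ (solve 1 (λ c → c := :- (:- c)) ≃-refl c) c>0) b<0 (Pos-reverse a<b))
  ... | inj₂ a<0 | inj₂ b<0 | inj₂ c<0 = relabel τ₁₃
    (label-missing (permuted conf τ₁₃) (swap₁₃ (negate τ)) c<0 (Pos-reverse b<c) (Pos-reverse a<b))

  label-a<b : ∀ {S a b c} → IsConfiguration S → Transversal S a b c → Pos (b ⊝ a) → Labelling S
  label-a<b conf τ a<b = [ c<b⇒ , label-sorted conf τ a<b ]′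
    -- `values-distinct` speaks only of the first two values; transpositions bring the other pairs
    -- there, and c is then inserted into a < b.
    (compare (values-distinct (permuted conf τ₁₃) (swap₁₃ τ)))
    where
    conf₂₃ = permuted conf τ₂₃
    c<b⇒ = λ c<b → relabel τ₂₃ ([ (λ a<c → label-sorted conf₂₃ (swap₂₃ τ) a<c c<b)
      , (λ c<a → relabel τ₁₂ (label-sorted (permuted conf₂₃ τ₁₂) (swap₁₂ (swap₂₃ τ)) c<a a<b)) ]′
      (compare (values-distinct conf₂₃ (swap₂₃ τ))))

  label : ∀ {S} → IsConfiguration S → Labelling S
  label conf = let _ , _ , _ , τ = transversal conf in
    [ label-a<b conf τ , (λ b<a → relabel τ₁₂ (label-a<b (permuted conf τ₁₂) (swap₁₂ τ) b<a)) ]′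
      (compare (values-distinct conf τ))

-- Rational values determined by two of the ratios

fromℚ-cong : ∀ {p q} → p ≡ q → fromℚ p ≃ fromℚ q
fromℚ-cong refl = ≃-refl

≃fromℚ-+ : ∀ {x y p q} → x ≃ fromℚ p → y ≃ fromℚ q → x ⊕ y ≃ fromℚ (p ℚ.+ q)
≃fromℚ-+ {p = p} {q} x≃p y≃q = ≃-trans (⊕-cong x≃p y≃q) (≃-sym (fromℚ-+ p q))

≃fromℚ-* : ∀ {x y p q} → x ≃ fromℚ p → y ≃ fromℚ q → x ⊗ y ≃ fromℚ (p ℚ.* q)
≃fromℚ-* {p = p} {q} x≃p y≃q = ≃-trans (⊗-cong x≃p y≃q) (≃-sym (fromℚ-* p q))

≃fromℚ-- : ∀ {x y p q} → x ≃ fromℚ p → y ≃ fromℚ q → x ⊝ y ≃ fromℚ (p ℚ.- q)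
≃fromℚ-- {p = p} {q} x≃p y≃q = ≃fromℚ-+ x≃p (≃-trans (⊖-cong y≃q) (≃-sym (fromℚ-neg q)))

≃fromℚ-÷ : ∀ {c x y p q} → ¬ c ≃ 0ℝ → c ⊗ x ≃ y → y ≃ fromℚ p → c ≃ fromℚ q →
  x ≃ fromℚ (p ℚ.* recip q)
≃fromℚ-÷ {c} {x} {y} {p} {q} c≄0 cx≃y y≃p c≃q = difference⁻¹ (cancel c≄0
  (by (1ℝ · cx≃y ⊞ 1ℝ · y≃p ⊞ ⊖ r · c≃q ⊞ ⊖ 1ℝ · qr≃p)
    (solve 6 (λ c x y p q r →
      c :* (x :- r) :- 0ₚ
      := 1ₚ :* (c :* x :- y) :+ (1ₚ :* (y :- p) :+ ((:- r) :* (c :- q) :+ (:- 1ₚ) :* (q :* r :- p))))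
      ≃-refl c x y (fromℚ p) (fromℚ q) r)))
  where
  r = fromℚ (p ℚ.* recip q)
  q≢0 : q ≢ 0ℚ
  q≢0 q≡0 = c≄0 (≃-trans c≃q (fromℚ-cong q≡0))
  qr≃p : fromℚ q ⊗ r ≃ fromℚ p
  qr≃p = ≃-trans (≃-sym (fromℚ-* q _)) (fromℚ-cong (begin
    q ℚ.* (p ℚ.* recip q)  ≡⟨ x∙yz≈y∙xz q p (recip q) ⟩
    p ℚ.* (q ℚ.* recip q)  ≡⟨ cong (p ℚ.*_) (*-recip q≢0) ⟩
    p ℚ.* 1ℚ               ≡⟨ ℚ.*-identityʳ p ⟩
    p                      ∎))
    where
    open ≡-Reasoning
    open import Algebra.Properties.CommutativeSemigroup
      (CommutativeMonoid.commutativeSemigroup ℚ.*-1-commutativeMonoid) using (x∙yz≈y∙xz)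

Relations-swap : ∀ {b₁ b₂ b₃ b₄} → Relations b₁ b₂ b₃ b₄ → Relations b₂ b₁ b₄ b₃
Relations-swap (relations b₁>0 b₂>0 b₃>0 b₄>0 b₂b₃≃ b₁b₄≃) =
  relations b₂>0 b₁>0 b₄>0 b₃>0 b₁b₄≃ b₂b₃≃

module _ {b₁ b₂ b₃ b₄ : ℝ} (rel : Relations b₁ b₂ b₃ b₄) where
  open Relations rel

  b₂⇐b₁b₃ : (b₃ ⊝ b₁) ⊗ b₂ ≃ b₁
  b₂⇐b₁b₃ = by (1ℝ · b₂b₃≃) (solve 3 (λ b₁ b₂ b₃ →
    (b₃ :- b₁) :* b₂ :- b₁ := 1ₚ :* (b₂ :* b₃ :- b₁ :* (b₂ :+ 1ₚ))) ≃-refl b₁ b₂ b₃)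

  -- Permits the division by b₃ - b₁: its product with b₂ is b₁, which is positive.
  b₁≄b₃ : ¬ b₃ ⊝ b₁ ≃ 0ℝ
  b₁≄b₃ b₃-b₁≃0 = pos⇒≄0 b₁>0 (≃-trans (≃-sym b₂⇐b₁b₃)
    (≃-trans (⊗-comm (b₃ ⊝ b₁) b₂) (⊗-≃0 b₂ b₃-b₁≃0)))

  b₂⇐b₁b₄ : (b₁ ⊕ 1ℝ) ⊗ b₂ ≃ b₁ ⊗ b₄
  b₂⇐b₁b₄ = ≃-trans (⊗-comm (b₁ ⊕ 1ℝ) b₂) (≃-sym b₁b₄≃)

  -- Adding b₃ times the second relation to the first cancels b₂b₃ and leaves a multiple of b₁,
  -- which is positive and can be removed.
  b₂⇐b₃b₄ : (b₃ ⊕ 1ℝ) ⊗ b₂ ≃ b₃ ⊗ b₄ ⊝ 1ℝ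
  b₂⇐b₃b₄ = difference⁻¹ (cancel-pos b₁>0 (by (⊖ 1ℝ · b₂b₃≃ ⊞ ⊖ b₃ · b₁b₄≃)
    (solve 4 (λ b₁ b₂ b₃ b₄ →
      b₁ :* ((b₃ :+ 1ₚ) :* b₂ :- (b₃ :* b₄ :- 1ₚ)) :- 0ₚ
      := (:- 1ₚ) :* (b₂ :* b₃ :- b₁ :* (b₂ :+ 1ₚ)) :+ (:- b₃) :* (b₁ :* b₄ :- b₂ :* (b₁ :+ 1ₚ)))
      ≃-refl b₁ b₂ b₃ b₄)))

-- b₁ and b₂ computed from b i = p and b j = q; the value for i = j is irrelevant.
firstTwo : Fin 4 → Fin 4 → ℚ → ℚ → ℚ × ℚ
firstTwo 0F 1F p q = p , q
firstTwo 0F 2F p q = p , p ℚ.* recip (q ℚ.- p)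
firstTwo 0F 3F p q = p , p ℚ.* q ℚ.* recip (p ℚ.+ 1ℚ)
firstTwo 1F 2F p q = p ℚ.* q ℚ.* recip (p ℚ.+ 1ℚ) , p
firstTwo 1F 3F p q = p ℚ.* recip (q ℚ.- p) , p
firstTwo 2F 3F p q = (q ℚ.* p ℚ.- 1ℚ) ℚ.* recip (q ℚ.+ 1ℚ) , (p ℚ.* q ℚ.- 1ℚ) ℚ.* recip (p ℚ.+ 1ℚ)
firstTwo 1F 0F p q = firstTwo 0F 1F q p
firstTwo 2F 0F p q = firstTwo 0F 2F q p
firstTwo 3F 0F p q = firstTwo 0F 3F q p
firstTwo 2F 1F p q = firstTwo 1F 2F q p
firstTwo 3F 1F p q = firstTwo 1F 3F q p
firstTwo 3F 2F p q = firstTwo 2F 3F q p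
firstTwo _ _ p q = p , q

allFour : ℚ × ℚ → Fin 4 → ℚ
allFour (p , q) 0F = p
allFour (p , q) 1F = q
allFour (p , q) 2F = p ℚ.* (q ℚ.+ 1ℚ) ℚ.* recip q
allFour (p , q) 3F = q ℚ.* (p ℚ.+ 1ℚ) ℚ.* recip p

pos+1≄0 : ∀ {b} → Pos b → ¬ b ⊕ 1ℝ ≃ 0ℝ
pos+1≄0 b>0 = pos⇒≄0 (Pos-+ b>0 Pos-1)

module _ {b : Fin 4 → ℝ} (rel : Relations (b 0F) (b 1F) (b 2F) (b 3F)) where
  open Relations rel

  firstTwo-correct : ∀ i j → i ≢ j → ∀ {p q} → b i ≃ fromℚ p → b j ≃ fromℚ q →
    b 0F ≃ fromℚ (proj₁ (firstTwo i j p q)) × b 1F ≃ fromℚ (proj₂ (firstTwo i j p q))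
  firstTwo-correct 0F 1F i≢j p≃ q≃ = p≃ , q≃
  firstTwo-correct 0F 2F i≢j p≃ q≃ =
    p≃ , ≃fromℚ-÷ (b₁≄b₃ rel) (b₂⇐b₁b₃ rel) p≃ (≃fromℚ-- q≃ p≃)
  firstTwo-correct 0F 3F i≢j p≃ q≃ =
    p≃ , ≃fromℚ-÷ (pos+1≄0 b₁>0) (b₂⇐b₁b₄ rel) (≃fromℚ-* p≃ q≃) (≃fromℚ-+ p≃ ≃-refl)
  firstTwo-correct 1F 2F i≢j p≃ q≃ =
    ≃fromℚ-÷ (pos+1≄0 b₂>0) (b₂⇐b₁b₄ (Relations-swap rel)) (≃fromℚ-* p≃ q≃) (≃fromℚ-+ p≃ ≃-refl) , p≃
  firstTwo-correct 1F 3F i≢j p≃ q≃ =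
    ≃fromℚ-÷ (b₁≄b₃ (Relations-swap rel)) (b₂⇐b₁b₃ (Relations-swap rel)) p≃ (≃fromℚ-- q≃ p≃) , p≃
  firstTwo-correct 2F 3F i≢j p≃ q≃ =
    ≃fromℚ-÷ (pos+1≄0 b₄>0) (b₂⇐b₃b₄ (Relations-swap rel))
      (≃fromℚ-- (≃fromℚ-* q≃ p≃) ≃-refl) (≃fromℚ-+ q≃ ≃-refl) ,
    ≃fromℚ-÷ (pos+1≄0 b₃>0) (b₂⇐b₃b₄ rel)
      (≃fromℚ-- (≃fromℚ-* p≃ q≃) ≃-refl) (≃fromℚ-+ p≃ ≃-refl)
  firstTwo-correct 1F 0F i≢j p≃ q≃ = firstTwo-correct 0F 1F (λ ()) q≃ p≃
  firstTwo-correct 2F 0F i≢j p≃ q≃ = firstTwo-correct 0F 2F (λ ()) q≃ p≃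
  firstTwo-correct 3F 0F i≢j p≃ q≃ = firstTwo-correct 0F 3F (λ ()) q≃ p≃
  firstTwo-correct 2F 1F i≢j p≃ q≃ = firstTwo-correct 1F 2F (λ ()) q≃ p≃
  firstTwo-correct 3F 1F i≢j p≃ q≃ = firstTwo-correct 1F 3F (λ ()) q≃ p≃
  firstTwo-correct 3F 2F i≢j p≃ q≃ = firstTwo-correct 2F 3F (λ ()) q≃ p≃
  firstTwo-correct 0F 0F i≢j _ _ = contradiction refl i≢j
  firstTwo-correct 1F 1F i≢j _ _ = contradiction refl i≢j
  firstTwo-correct 2F 2F i≢j _ _ = contradiction refl i≢j
  firstTwo-correct 3F 3F i≢j _ _ = contradiction refl i≢j

  allFour-correct : ∀ {p q} → b 0F ≃ fromℚ p → b 1F ≃ fromℚ q → ∀ k → b k ≃ fromℚ (allFour (p , q) k)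
  allFour-correct p≃ q≃ 0F = p≃
  allFour-correct p≃ q≃ 1F = q≃
  allFour-correct p≃ q≃ 2F =
    ≃fromℚ-÷ (pos⇒≄0 b₂>0) b₂b₃≃ (≃fromℚ-* p≃ (≃fromℚ-+ q≃ ≃-refl)) q≃
  allFour-correct p≃ q≃ 3F =
    ≃fromℚ-÷ (pos⇒≄0 b₁>0) b₁b₄≃ (≃fromℚ-* q≃ (≃fromℚ-+ p≃ ≃-refl)) p≃

  determined : ∀ i j → i ≢ j → ∀ {p q} → b i ≃ fromℚ p → b j ≃ fromℚ q →
    ∀ k → b k ≃ fromℚ (allFour (firstTwo i j p q) k)
  determined i j i≢j p≃ q≃ = let p≃′ , q≃′ = firstTwo-correct i j i≢j p≃ q≃ in allFour-correct p≃′ q≃′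

opaque
  unfolding _⊕_

  product-relations : ∀ {b₁ b₂ b₃ b₄} → Relations b₁ b₂ b₃ b₄ →
    (b₂ * b₃ ≈ b₁ * (b₂ + 1ℝ)) × (b₁ * b₄ ≈ (b₁ + 1ℝ) * b₂)
  product-relations {b₁} {b₂} (relations _ _ _ _ b₂b₃≃ b₁b₄≃) =
    unwrap b₂b₃≃ , unwrap (≃-trans b₁b₄≃ (⊗-comm b₂ (b₁ ⊕ 1ℝ)))

lemma4p5 : (S : Fin 4 → Segment) → IsConfiguration S →
    (ExcludedMiddle 0ℓ → Labelling S)
    × ((b : Fin 4 → ℝ) → HasRatios S b →
    (b 1F * b 2F ≈ b 0F * (b 1F + 1ℝ))
    × (b 0F * b 3F ≈ (b 0F + 1ℝ) * b 1F)
    × ((i j : Fin 4) → i ≢ j → (p q : ℚ) → b i ≈ fromℚ p → b j ≈ fromℚ q →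
    Σ[ r ∈ (Fin 4 → ℚ) ]
    ((k : Fin 4) → b k ≈ fromℚ (r k))
    × ((S′ : Fin 4 → Segment) → IsConfiguration S′ →
    (b′ : Fin 4 → ℝ) → HasRatios S′ b′ →
    b′ i ≈ fromℚ p → b′ j ≈ fromℚ q →
    (k : Fin 4) → b′ k ≈ fromℚ (r k))))
lemma4p5 S conf = (λ em → label em conf) , λ b has →
  let rel           = hasRatios⇒relations conf b has
      b₂b₃≈ , b₁b₄≈ = product-relations rel
  in b₂b₃≈ , b₁b₄≈ , λ i j i≢j p q bᵢ≈p bⱼ≈q →
    -- This witness is computed from i, j, p and q alone, so it serves every other configuration
    -- with the same two values.
    allFour (firstTwo i j p q)
    , (λ k → unwrap (determined {b} rel i j i≢j (wrap bᵢ≈p) (wrap bⱼ≈q) k))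
    , λ S′ conf′ b′ has′ b′ᵢ≈p b′ⱼ≈q k → unwrap
        (determined {b′} (hasRatios⇒relations conf′ b′ has′) i j i≢j (wrap b′ᵢ≈p) (wrap b′ⱼ≈q) k)
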